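{- Let $M\ge 1$ be an integer and let $1<r\le M+1$ be a real number. For (Lebesgue) almost all $q\in(1,r)$ there exist arbitrarily large integers $m$ such that the word $\beta_1(q)\cdots\beta_m(q)$ ends with more than $\log_r m$ consecutive zero digits.
   Context: For a real base $q>1$, an expansion of a real number $x$ in base $q$ is a sequence $(c_i)\in\{0,1,\ldots,M\}^\infty$ with $\sum_{i=1}^\infty c_i q^{ -i}=x$. For $q\in(1,M+1]$, $\beta(q)=(\beta_i(q))_{i\ge1}$ denotes the lexicographically largest expansion (the greedy expansion) of $x=1$ in base $q$ over the alphabet $\{0,\ldots,M\}$. -}

module Defs where

open import Algebra.Bundles using (CommutativeRing; Semiring)
open import Data.Fin.Base as Fin using (Fin; toℕ)
open import Data.List.Base using (List; applyUpTo; replicate; _++_)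
open import Data.Nat.Base as ℕ using (ℕ; zero; suc)
open import Data.Product.Base using (_×_; ∃; ∃₂)
open import Data.Sum.Base using (_⊎_)
open import Level using (0ℓ) renaming (suc to lsuc)
open import Relation.Binary.Core using (Rel)
open import Relation.Binary.PropositionalEquality.Core using (_≡_)
open import Relation.Binary.Structures using (IsStrictTotalOrder)
open import Relation.Nullary.Negation.Core using (¬_)
open import Relation.Unary using (Pred)
import Algebra.Definitions.RawSemiring as RawSemiringDefs
import Relation.Binary.Construct.StrictToNonStrict as StrictToNonStrict

-- The real numbers are taken axiomatically, as a Dedekind-complete ordered
-- field; classically these axioms determine ℝ up to unique isomorphism.

record CompleteOrderedField : Set (lsuc 0ℓ) where
  field
    commutativeRing : CommutativeRing 0ℓ 0ℓ

  open CommutativeRing commutativeRing public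

  infix 4 _<_
  infix 9 _⁻¹

  field
    _<_                : Rel Carrier 0ℓ
    isStrictTotalOrder : IsStrictTotalOrder _≈_ _<_
    0<1                : 0# < 1#
    +-monoˡ-<          : ∀ {x y} z → x < y → x + z < y + z
    *-pos              : ∀ {x y} → 0# < x → 0# < y → 0# < x * y

    -- Nothing is assumed about the value of 0# ⁻¹.
    _⁻¹                : Carrier → Carrier
    *-inverseʳ         : ∀ {x} → ¬ x ≈ 0# → x * x ⁻¹ ≈ 1#

  open StrictToNonStrict _≈_ _<_ public using (_≤_)

  UpperBound : Pred Carrier 0ℓ → Pred Carrier 0ℓ
  UpperBound P b = ∀ x → P x → x ≤ b

  Supremum : Pred Carrier 0ℓ → Pred Carrier 0ℓ
  Supremum P s = UpperBound P s × (∀ b → UpperBound P b → s ≤ b)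

  field
    complete : (P : Pred Carrier 0ℓ) → ∃ P → ∃ (UpperBound P) → ∃ (Supremum P)

module RealAnalysis (R : CompleteOrderedField) where
  open CompleteOrderedField R
  open RawSemiringDefs (Semiring.rawSemiring semiring) using (_^_; sum) renaming (_×_ to _·_)

  fromℕ : ℕ → Carrier
  fromℕ n = n · 1#

  partialSum : (ℕ → Carrier) → ℕ → Carrier
  partialSum f n = sum {n} (λ i → f (toℕ i))

  _ConvergesTo_ : (ℕ → Carrier) → Carrier → Set
  f ConvergesTo x = ∀ ε → 0# < ε →
    ∃ λ N → ∀ n → N ℕ.≤ n → (x - ε < f n) × (f n < x + ε)

  -- Lebesgue measure zero: for every ε > 0 the set is covered by countably
  -- many open intervals (a i , b i) of total length at most ε. The lengths are
  -- nonnegative, so bounding their sum is bounding all its partial sums.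
  Null : Pred Carrier 0ℓ → Set
  Null P = ∀ ε → 0# < ε → ∃₂ λ (a b : ℕ → Carrier) →
      (∀ i → a i ≤ b i)
    × (∀ n → partialSum (λ i → b i - a i) n ≤ ε)
    × (∀ x → P x → ∃ λ i → (a i < x) × (x < b i))

  AlmostEverywhereOn : Pred Carrier 0ℓ → Pred Carrier 0ℓ → Set
  AlmostEverywhereOn S P = Null (λ x → S x × ¬ P x)

  OpenInterval : Carrier → Carrier → Pred Carrier 0ℓ
  OpenInterval a b x = (a < x) × (x < b)

  -- ℓ = log_r x, for r > 1 and x ≥ 1, as the supremum of the rationals a/b ≥ 0
  -- with r^(a/b) ≤ x, i.e. with r^a ≤ x^b (b is written suc b below).
  -- For x = 0 the set is empty and no ℓ qualifies.
  IsLog : Carrier → Carrier → Carrier → Set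
  IsLog r x ℓ = Supremum
    (λ p → ∃₂ λ a b → (p ≈ fromℕ a * (fromℕ (suc b)) ⁻¹)
                    × (r ^ a ≤ x ^ suc b))
    ℓ

  module _ {M : ℕ} where

    -- Sequences are indexed from 0, so c i is the digit usually written
    -- c_{i+1}; this accounts for the exponent suc i in the expansion.
    DigitSeq : Set
    DigitSeq = ℕ → Fin (suc M)

    IsExpansion : Carrier → Carrier → DigitSeq → Set
    IsExpansion q x c =
      partialSum (λ i → fromℕ (toℕ (c i)) * (q ⁻¹) ^ suc i) ConvergesTo x

    _<lex_ : DigitSeq → DigitSeq → Set
    c <lex d = ∃ λ n → (∀ i → i ℕ.< n → c i ≡ d i) × (c n Fin.< d n)

    _≤lex_ : DigitSeq → DigitSeq → Set
    c ≤lex d = (∀ i → c i ≡ d i) ⊎ (c <lex d)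

    IsGreedyExpansion : Carrier → Carrier → DigitSeq → Set
    IsGreedyExpansion q x c =
      IsExpansion q x c × (∀ d → IsExpansion q x d → d ≤lex c)

    EndsWithZeros : ℕ → List (Fin (suc M)) → Set
    EndsWithZeros k w = ∃ λ u → w ≡ u ++ replicate k Fin.zero

    -- applyUpTo β m is the word formed by the first m digits of β.
    HasLongZeroRuns : Carrier → DigitSeq → Set
    HasLongZeroRuns r β = ∀ N → ∃ λ m → (N ℕ.≤ m) ×
      ∃₂ λ k ℓ → EndsWithZeros k (applyUpTo β m)
               × IsLog r (fromℕ m) ℓ
               × (ℓ < fromℕ k)

  -- β(q) is unique when it exists; its existence is part of the assertion.
  GreedyHasLongZeroRuns : ℕ → Carrier → Pred Carrier 0ℓ
  GreedyHasLongZeroRuns M r q = ∃ λ (β : DigitSeq {M}) →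
    IsGreedyExpansion q 1# β × HasLongZeroRuns r β

{-# OPTIONS --safe #-}

-- Let T^n(q) be the remainder q^n - Σ_{i≤n} β_i q^{n-i} of the greedy expansion
-- of 1. The bases with given digits β_1 … β_n form an interval on which
-- q ↦ T^n(q) vanishes at the left end, is at most 1, and is increasing and convex,
-- since T^{n+1}(q) = q T^n(q) - β_{n+1}. If q ≤ s < r, the next k digits are 0 as
-- soon as T^n(q) ≤ s^{-k}, and by convexity this happens on at least the fraction
-- s^{-k} of the interval. Hence J consecutive attempts of length k all fail only on
-- a set of measure at most (s - 1) (1 - s^{-k})^J. With J a large multiple of s^k
-- this is arbitrarily small, while the attempts still end before the digit with
-- index r^{k-1}, whose logarithm to the base r is k - 1 < k.

module Submission where

open import Defs
open import Axiom.ExcludedMiddle using (ExcludedMiddle)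
open import Algebra.Bundles using (CommutativeRing; RawRing)
open import Algebra.Solver.Ring.AlmostCommutativeRing
  using (fromCommutativeRing; _-Raw-AlmostCommutative⟶_)
open import Data.Fin.Base as Fin using (Fin; toℕ)
open import Data.Integer.Base as ℤ using (ℤ; +_; -[1+_])
open import Data.List.Base using (List; []; _∷_; _++_; applyUpTo; concatMap; map; replicate)
open import Data.List.Relation.Unary.Any as Any using (Any; here; there)
open import Data.List.Relation.Unary.Any.Properties using (++⁺ˡ; ++⁺ʳ; concatMap⁺; map⁺)
open import Data.Maybe.Base using (Maybe; just; nothing)
open import Data.Nat.Base as ℕ using (ℕ; zero; suc)
open import Data.Nat.Induction using (<-rec)
open import Data.Product.Base using (_×_; _,_; ∃; ∃₂; proj₁; proj₂)
open import Data.Sum.Base as Sum using (_⊎_; inj₁; inj₂; [_,_]′)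
open import Function.Base using (_∘_; id)
open import Level using (0ℓ)
open import Relation.Binary.Definitions using (tri<; tri≈; tri>)
open import Relation.Binary.PropositionalEquality.Core as ≡ using (_≡_; _≢_)
open import Relation.Binary.Structures using (IsStrictTotalOrder)
open import Relation.Nullary.Decidable using (yes; no; decidable-stable)
open import Relation.Nullary.Negation.Core using (¬_; contradiction)
import Algebra.Properties.Ring as RingProperties
import Algebra.Properties.Semiring.Exp as Exp
import Algebra.Properties.Semiring.Mult as Mult
import Algebra.Properties.Semiring.Mult.TCOptimised as OptimisedMult
import Algebra.Solver.Ring as RingSolver
import Data.Fin.Properties as Fin
import Data.Integer.Properties as ℤ
import Data.Nat.Properties as ℕ
import Relation.Binary.Construct.StrictToNonStrict as StrictToNonStrict
import Relation.Binary.Reasoning.Setoid as SetoidReasoning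

-- Two obstacles shape the proof. A cylinder need not be full: at its right end the value may stay
-- below 1, so successive digits are not independent. The chord bound asks only for the value 0 at
-- the left end and at most 1 at the right end, so every cylinder loses the same fraction, whatever
-- its earlier digits. The other obstacle is the length of the attempts. Together they read about
-- `k * s ^ k` digits up to a constant, which for `s = r` would eventually exceed `r ^ k`; for
-- `s < r` the power `(r / s) ^ k` absorbs the factor `k` and all constants. Hence `s` is chosen
-- close to `r`, depending on `ε`, and the bases from `s` to `r` are covered by one short interval.
-- Arbitrarily large `m` come from one such construction for each `N`, started beyond the digit `N`;
-- the tolerances form a geometric series with sum at most `ε`.

-- Ring solver with integer coefficients.

module IntegerCoefficientSolver {c ℓ} (R : CommutativeRing c ℓ) where
  open CommutativeRing R
  open OptimisedMult semiring using (×1-homo-*; ×-homo-+; 1+×) renaming (_×_ to _·_)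
  open RingProperties ring
    using (-0#≈0#; -‿involutive; -‿distribˡ-*; -‿distribʳ-*; -‿+-comm)
  open SetoidReasoning setoid

  private
    ℤ-rawRing : RawRing _ _
    ℤ-rawRing = record
      { Carrier = ℤ ; _≈_ = _≡_ ; _+_ = ℤ._+_ ; _*_ = ℤ._*_ ; -_ = ℤ.-_ ; 0# = + 0 ; 1# = + 1 }

    ⟦_⟧ : ℤ → Carrier
    ⟦ + n ⟧      = n · 1#
    ⟦ -[1+ n ] ⟧ = - (suc n · 1#)

    ⟦⟧-homo-neg : ∀ i → ⟦ ℤ.- i ⟧ ≈ - ⟦ i ⟧
    ⟦⟧-homo-neg (+ zero)    = sym -0#≈0#
    ⟦⟧-homo-neg (+ (suc n)) = refl
    ⟦⟧-homo-neg -[1+ n ]    = sym (-‿involutive _)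

    ⟦⟧-⊖ : ∀ m n → ⟦ m ℤ.⊖ n ⟧ ≈ m · 1# - n · 1#
    ⟦⟧-⊖ m       zero    = sym (trans (+-congˡ -0#≈0#) (+-identityʳ _))
    ⟦⟧-⊖ zero    (suc n) = sym (+-identityˡ _)
    ⟦⟧-⊖ (suc m) (suc n) rewrite ℤ.[1+m]⊖[1+n]≡m⊖n m n = begin
      ⟦ m ℤ.⊖ n ⟧                             ≈⟨ ⟦⟧-⊖ m n ⟩
      m · 1# - n · 1#                         ≈⟨ +-congʳ (+-identityˡ _) ⟨
      0# + m · 1# - n · 1#                    ≈⟨ +-congʳ (+-congʳ (-‿inverseʳ 1#)) ⟨
      1# - 1# + m · 1# - n · 1#               ≈⟨ +-congʳ (+-assoc _ _ _) ⟩
      1# + (- 1# + m · 1#) - n · 1#           ≈⟨ +-congʳ (+-congˡ (+-comm _ _)) ⟩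
      1# + (m · 1# - 1#) - n · 1#             ≈⟨ +-congʳ (+-assoc _ _ _) ⟨
      1# + m · 1# - 1# - n · 1#               ≈⟨ +-assoc _ _ _ ⟩
      1# + m · 1# + (- 1# - n · 1#)           ≈⟨ +-congˡ (-‿+-comm _ _) ⟩
      1# + m · 1# - (1# + n · 1#)             ≈⟨ +-cong (1+× m 1#) (-‿cong (1+× n 1#)) ⟨
      suc m · 1# - suc n · 1#                 ∎

    ⟦⟧-homo-+ : ∀ i j → ⟦ i ℤ.+ j ⟧ ≈ ⟦ i ⟧ + ⟦ j ⟧
    ⟦⟧-homo-+ (+ m)    (+ n)    = ×-homo-+ 1# m n
    ⟦⟧-homo-+ (+ m)    -[1+ n ] = ⟦⟧-⊖ m (suc n)
    ⟦⟧-homo-+ -[1+ m ] (+ n)    = trans (⟦⟧-⊖ n (suc m)) (+-comm _ _)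
    ⟦⟧-homo-+ -[1+ m ] -[1+ n ] = begin
      - (suc (suc (m ℕ.+ n)) · 1#)      ≡⟨ ≡.cong (λ k → - (suc k · 1#)) (ℕ.+-suc m n) ⟨
      - (suc (m ℕ.+ suc n) · 1#)        ≈⟨ -‿cong (×-homo-+ 1# (suc m) (suc n)) ⟩
      - (suc m · 1# + suc n · 1#)       ≈⟨ -‿+-comm _ _ ⟨
      - (suc m · 1#) - suc n · 1#       ∎

    ⟦⟧-homo-* : ∀ i j → ⟦ i ℤ.* j ⟧ ≈ ⟦ i ⟧ * ⟦ j ⟧
    ⟦⟧-homo-* (+ m)    (+ n)    rewrite ℤ.+◃n≡+n (m ℕ.* n) = ×1-homo-* m n
    ⟦⟧-homo-* (+ m)    -[1+ n ] rewrite ℤ.-◃n≡-n (m ℕ.* suc n) = begin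
      ⟦ ℤ.- (+ (m ℕ.* suc n)) ⟧    ≈⟨ ⟦⟧-homo-neg (+ (m ℕ.* suc n)) ⟩
      - ((m ℕ.* suc n) · 1#)       ≈⟨ -‿cong (×1-homo-* m (suc n)) ⟩
      - (m · 1# * suc n · 1#)      ≈⟨ -‿distribʳ-* _ _ ⟩
      m · 1# * - (suc n · 1#)      ∎
    ⟦⟧-homo-* -[1+ m ] (+ n)    rewrite ℤ.-◃n≡-n (suc m ℕ.* n) = begin
      ⟦ ℤ.- (+ (suc m ℕ.* n)) ⟧    ≈⟨ ⟦⟧-homo-neg (+ (suc m ℕ.* n)) ⟩
      - ((suc m ℕ.* n) · 1#)       ≈⟨ -‿cong (×1-homo-* (suc m) n) ⟩
      - (suc m · 1# * n · 1#)      ≈⟨ -‿distribˡ-* _ _ ⟩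
      - (suc m · 1#) * n · 1#      ∎
    ⟦⟧-homo-* -[1+ m ] -[1+ n ] = begin
      (suc m ℕ.* suc n) · 1#              ≈⟨ ×1-homo-* (suc m) (suc n) ⟩
      suc m · 1# * suc n · 1#             ≈⟨ -‿involutive _ ⟨
      - - (suc m · 1# * suc n · 1#)       ≈⟨ -‿cong (-‿distribʳ-* _ _) ⟩
      - (suc m · 1# * - (suc n · 1#))     ≈⟨ -‿distribˡ-* _ _ ⟩
      - (suc m · 1#) * - (suc n · 1#)     ∎

    morphism : ℤ-rawRing -Raw-AlmostCommutative⟶ fromCommutativeRing R
    morphism = record
      { ⟦_⟧ = ⟦_⟧ ; +-homo = ⟦⟧-homo-+ ; *-homo = ⟦⟧-homo-* ; -‿homo = ⟦⟧-homo-neg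
      ; 0-homo = refl ; 1-homo = refl }

    coefficient≟ : ∀ i j → Maybe (⟦ i ⟧ ≈ ⟦ j ⟧)
    coefficient≟ i j with i ℤ.≟ j
    ... | yes ≡.refl = just refl
    ... | no _       = nothing

  open RingSolver ℤ-rawRing (fromCommutativeRing R) morphism coefficient≟ public
    using (Polynomial; solve; _:=_; con; _:+_; _:*_; _:-_; :-_)

  -- With the optimised multiples these constants evaluate to `0#` and `1#` themselves, so solved
  -- equations match their goals by `refl`.
  :0 :1 : ∀ {n} → Polynomial n
  :0 = con (+ 0)
  :1 = con (+ 1)

-- Inequalities, powers and integers in a complete ordered field.

module OrderedFieldProperties (ℝ : CompleteOrderedField) where
  open CompleteOrderedField ℝ hiding (zero)
  open RealAnalysis ℝ
  open IntegerCoefficientSolver commutativeRing public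
  open Exp semiring using (_^_; ^-congˡ; ^-homo-*) public
  open IsStrictTotalOrder isStrictTotalOrder public
    using (compare; irrefl; asym; _<?_; <-respʳ-≈; <-respˡ-≈)
    renaming (trans to <-trans)

  private module NonStrict = StrictToNonStrict _≈_ _<_

  ≤-refl : ∀ {x} → x ≤ x
  ≤-refl = inj₂ refl

  <⇒≤ : ∀ {x y} → x < y → x ≤ y
  <⇒≤ = inj₁

  ≈⇒≤ : ∀ {x y} → x ≈ y → x ≤ y
  ≈⇒≤ = inj₂

  ≤-trans : ∀ {x y z} → x ≤ y → y ≤ z → x ≤ z
  ≤-trans = NonStrict.trans isEquivalence
    (IsStrictTotalOrder.<-resp-≈ isStrictTotalOrder) <-trans

  <-≤-trans : ∀ {x y z} → x < y → y ≤ z → x < z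
  <-≤-trans = NonStrict.<-≤-trans <-trans <-respʳ-≈

  ≤-<-trans : ∀ {x y z} → x ≤ y → y < z → x < z
  ≤-<-trans = NonStrict.≤-<-trans sym <-trans <-respˡ-≈

  <⇒≱ : ∀ {x y} → x < y → ¬ y ≤ x
  <⇒≱ x<y y≤x = irrefl refl (<-≤-trans x<y y≤x)

  ≤-<-connex : ∀ x y → x ≤ y ⊎ y < x
  ≤-<-connex x y with compare x y
  ... | tri< x<y _ _ = inj₁ (inj₁ x<y)
  ... | tri≈ _ x≈y _ = inj₁ (inj₂ x≈y)
  ... | tri> _ _ y<x = inj₂ y<x

  ≮⇒≥ : ∀ {x y} → ¬ x < y → y ≤ x
  ≮⇒≥ {x} {y} x≮y with ≤-<-connex y x
  ... | inj₁ y≤x = y≤x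
  ... | inj₂ x<y = contradiction x<y x≮y

  ≰⇒> : ∀ {x y} → ¬ x ≤ y → y < x
  ≰⇒> {x} {y} x≰y with ≤-<-connex x y
  ... | inj₁ x≤y = contradiction x≤y x≰y
  ... | inj₂ y<x = y<x

  x<y⇒0<y-x : ∀ {x y} → x < y → 0# < y - x
  x<y⇒0<y-x {x} x<y = <-respˡ-≈ (-‿inverseʳ x) (+-monoˡ-< (- x) x<y)

  x≤y⇒0≤y-x : ∀ {x y} → x ≤ y → 0# ≤ y - x
  x≤y⇒0≤y-x (inj₁ x<y) = inj₁ (x<y⇒0<y-x x<y)
  x≤y⇒0≤y-x (inj₂ x≈y) = inj₂ (trans (sym (-‿inverseʳ _)) (+-congʳ x≈y))

  -- An inequality x < y or x ≤ y is mostly proved by exhibiting a positive or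
  -- nonnegative expression for y - x.
  <-from : ∀ {x y d} → 0# < d → y - x ≈ d → x < y
  <-from {x} {y} 0<d y-x≈d =
    <-respˡ-≈ (+-identityˡ x) (<-respʳ-≈ (solve 2 (λ x y → (y :- x) :+ x := y) refl x y)
      (+-monoˡ-< x (<-respʳ-≈ (sym y-x≈d) 0<d)))

  ≤-from : ∀ {x y d} → 0# ≤ d → y - x ≈ d → x ≤ y
  ≤-from (inj₁ 0<d) y-x≈d = inj₁ (<-from 0<d y-x≈d)
  ≤-from {x} {y} (inj₂ 0≈d) y-x≈d = inj₂ (begin
    x              ≈⟨ +-identityˡ x ⟨
    0# + x         ≈⟨ +-congʳ (trans 0≈d (sym y-x≈d)) ⟩
    y - x + x      ≈⟨ solve 2 (λ x y → (y :- x) :+ x := y) refl x y ⟩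
    y              ∎)
    where open SetoidReasoning setoid

  0<+ : ∀ {x y} → 0# < x → 0# ≤ y → 0# < x + y
  0<+ {x} {y} 0<x 0≤y = ≤-<-trans 0≤y (<-from 0<x (solve 2 (λ x y → (x :+ y) :- y := x) refl x y))

  0≤+ : ∀ {x y} → 0# ≤ x → 0# ≤ y → 0# ≤ x + y
  0≤+ {x} {y} 0≤x 0≤y =
    ≤-trans 0≤y (≤-from 0≤x (solve 2 (λ x y → (x :+ y) :- y := x) refl x y))

  0≤* : ∀ {x y} → 0# ≤ x → 0# ≤ y → 0# ≤ x * y
  0≤* (inj₁ 0<x) (inj₁ 0<y) = inj₁ (*-pos 0<x 0<y)
  0≤* {x} {y} (inj₂ 0≈x) _  = inj₂ (trans (sym (zeroˡ y)) (*-congʳ 0≈x))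
  0≤* {x} {y} _ (inj₂ 0≈y)  = inj₂ (trans (sym (zeroʳ x)) (*-congˡ 0≈y))

  0≤1 : 0# ≤ 1#
  0≤1 = inj₁ 0<1

  +-mono-≤ : ∀ {w x y z} → w ≤ x → y ≤ z → w + y ≤ x + z
  +-mono-≤ {w} {x} {y} {z} w≤x y≤z = ≤-from (0≤+ (x≤y⇒0≤y-x w≤x) (x≤y⇒0≤y-x y≤z))
    (solve 4 (λ w x y z → (x :+ z) :- (w :+ y) := (x :- w) :+ (z :- y)) refl w x y z)

  *-monoˡ-≤ : ∀ {x y z} → 0# ≤ z → x ≤ y → z * x ≤ z * y
  *-monoˡ-≤ {x} {y} {z} 0≤z x≤y = ≤-from (0≤* 0≤z (x≤y⇒0≤y-x x≤y))
    (solve 3 (λ x y z → z :* y :- z :* x := z :* (y :- x)) refl x y z)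

  *-monoʳ-≤ : ∀ {x y z} → 0# ≤ z → x ≤ y → x * z ≤ y * z
  *-monoʳ-≤ {x} {y} {z} 0≤z x≤y = ≤-from (0≤* 0≤z (x≤y⇒0≤y-x x≤y))
    (solve 3 (λ x y z → y :* z :- x :* z := z :* (y :- x)) refl x y z)

  *-monoˡ-< : ∀ {x y z} → 0# < z → x < y → z * x < z * y
  *-monoˡ-< {x} {y} {z} 0<z x<y = <-from (*-pos 0<z (x<y⇒0<y-x x<y))
    (solve 3 (λ x y z → z :* y :- z :* x := z :* (y :- x)) refl x y z)

  *-monoʳ-< : ∀ {x y z} → 0# < z → x < y → x * z < y * z
  *-monoʳ-< {x} {y} {z} 0<z x<y = <-from (*-pos 0<z (x<y⇒0<y-x x<y))
    (solve 3 (λ x y z → y :* z :- x :* z := z :* (y :- x)) refl x y z)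

  *-mono-≤ : ∀ {w x y z} → 0# ≤ x → 0# ≤ y → w ≤ x → y ≤ z → w * y ≤ x * z
  *-mono-≤ 0≤x 0≤y w≤x y≤z = ≤-trans (*-monoʳ-≤ 0≤y w≤x) (*-monoˡ-≤ 0≤x y≤z)

  *-cancelˡ-≤ : ∀ {x y z} → 0# < z → z * x ≤ z * y → x ≤ y
  *-cancelˡ-≤ 0<z zx≤zy = ≮⇒≥ λ y<x → <⇒≱ (*-monoˡ-< 0<z y<x) zx≤zy

  x-y≤x : ∀ {x y} → 0# ≤ y → x - y ≤ x
  x-y≤x {x} {y} 0≤y = ≤-from 0≤y (solve 2 (λ x y → x :- (x :- y) := y) refl x y)

  x-y<x : ∀ {x y} → 0# < y → x - y < x
  x-y<x {x} {y} 0<y = <-from 0<y (solve 2 (λ x y → x :- (x :- y) := y) refl x y)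

  x≤x+y : ∀ {x y} → 0# ≤ y → x ≤ x + y
  x≤x+y {x} {y} 0≤y = ≤-from 0≤y (solve 2 (λ x y → (x :+ y) :- x := y) refl x y)

  x<x+y : ∀ {x y} → 0# < y → x < x + y
  x<x+y {x} {y} 0<y = <-from 0<y (solve 2 (λ x y → (x :+ y) :- x := y) refl x y)

  x-0≈x : ∀ x → x - 0# ≈ x
  x-0≈x = solve 1 (λ x → x :- :0 := x) refl

  *-inverseʳ-pos : ∀ {x} → 0# < x → x * x ⁻¹ ≈ 1#
  *-inverseʳ-pos 0<x = *-inverseʳ λ x≈0 → irrefl (sym x≈0) 0<x

  ⁻¹-pos : ∀ {x} → 0# < x → 0# < x ⁻¹
  ⁻¹-pos {x} 0<x = ≰⇒> λ x⁻¹≤0 → <⇒≱ 0<1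
    (≤-trans (≈⇒≤ (sym (*-inverseʳ-pos 0<x)))
      (≤-trans (*-monoˡ-≤ (<⇒≤ 0<x) x⁻¹≤0) (≈⇒≤ (zeroʳ x))))

  fromℕ-+ : ∀ m n → fromℕ (m ℕ.+ n) ≈ fromℕ m + fromℕ n
  fromℕ-+ = Mult.×-homo-+ semiring 1#

  fromℕ-* : ∀ m n → fromℕ (m ℕ.* n) ≈ fromℕ m * fromℕ n
  fromℕ-* = Mult.×1-homo-* semiring

  0≤fromℕ : ∀ n → 0# ≤ fromℕ n
  0≤fromℕ zero    = ≤-refl
  0≤fromℕ (suc n) = 0≤+ 0≤1 (0≤fromℕ n)

  0<fromℕ-suc : ∀ n → 0# < fromℕ (suc n)
  0<fromℕ-suc n = 0<+ 0<1 (0≤fromℕ n)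

  0≤x-fromℕ-suc⇒1≤x : ∀ {x} n → 0# ≤ x - fromℕ (suc n) → 1# ≤ x
  0≤x-fromℕ-suc⇒1≤x {x} n 0≤x-n = ≤-from (0≤+ 0≤x-n (0≤fromℕ n))
    (solve 2 (λ x n → x :- :1 := (x :- (:1 :+ n)) :+ n) refl x (fromℕ n))

  fromℕ-mono-≤ : ∀ {m n} → m ℕ.≤ n → fromℕ m ≤ fromℕ n
  fromℕ-mono-≤ {n = n} ℕ.z≤n = 0≤fromℕ n
  fromℕ-mono-≤ (ℕ.s≤s m≤n)   = +-mono-≤ ≤-refl (fromℕ-mono-≤ m≤n)

  fromℕ-1 : fromℕ 1 ≈ 1#
  fromℕ-1 = +-identityʳ 1#

  ^-pos : ∀ {x} → 0# < x → ∀ n → 0# < x ^ n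
  ^-pos 0<x zero    = 0<1
  ^-pos 0<x (suc n) = *-pos 0<x (^-pos 0<x n)

  1≤^ : ∀ {x} → 1# ≤ x → ∀ n → 1# ≤ x ^ n
  1≤^ 1≤x zero    = ≤-refl
  1≤^ 1≤x (suc n) = ≤-trans (≈⇒≤ (sym (*-identityˡ 1#)))
    (*-mono-≤ (≤-trans 0≤1 1≤x) 0≤1 1≤x (1≤^ 1≤x n))

  1<^ : ∀ {x} → 1# < x → ∀ n → 1# < x ^ suc n
  1<^ {x} 1<x n = <-≤-trans 1<x (≤-trans (≈⇒≤ (sym (*-identityʳ x)))
    (*-monoˡ-≤ (≤-trans 0≤1 (<⇒≤ 1<x)) (1≤^ (<⇒≤ 1<x) n)))

  ^-monoˡ-≤ : ∀ {x y} → 0# ≤ x → x ≤ y → ∀ n → x ^ n ≤ y ^ n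
  ^-monoˡ-≤ 0≤x x≤y zero    = ≤-refl
  ^-monoˡ-≤ {x} 0≤x x≤y (suc n) = *-mono-≤ (≤-trans 0≤x x≤y) (0≤^ n) x≤y (^-monoˡ-≤ 0≤x x≤y n)
    where
    0≤^ : ∀ n → 0# ≤ x ^ n
    0≤^ zero    = 0≤1
    0≤^ (suc n) = 0≤* 0≤x (0≤^ n)

  ^-monoʳ-< : ∀ {x} → 1# < x → ∀ {m n} → m ℕ.< n → x ^ m < x ^ n
  ^-monoʳ-< {x} 1<x {m} {n} m<n with ℕ.m≤n⇒∃[o]m+o≡n m<n
  ... | o , ≡.refl = <-respʳ-≈ (trans (sym (^-homo-* x m (suc o)))
                                      (reflexive (≡.cong (x ^_) (ℕ.+-suc m o))))
                       (<-respˡ-≈ (*-identityʳ (x ^ m))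
                         (*-monoˡ-< (^-pos (<-trans 0<1 1<x) m) (1<^ 1<x o)))

  1^ : ∀ n → 1# ^ n ≈ 1#
  1^ zero    = refl
  1^ (suc n) = trans (*-identityˡ _) (1^ n)

  ^-distrib-* : ∀ x y n → (x * y) ^ n ≈ x ^ n * y ^ n
  ^-distrib-* x y zero    = sym (*-identityˡ 1#)
  ^-distrib-* x y (suc n) = trans (*-congˡ (^-distrib-* x y n))
    (solve 4 (λ x y a b → x :* y :* (a :* b) := x :* a :* (y :* b)) refl x y (x ^ n) (y ^ n))

  bernoulli : ∀ {h} → 0# ≤ h → ∀ n → 1# + fromℕ n * h ≤ (1# + h) ^ n
  bernoulli {h} 0≤h zero    = ≈⇒≤ (solve 1 (λ h → :1 :+ :0 :* h := :1) refl h)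
  bernoulli {h} 0≤h (suc n) =
    ≤-trans
      (≤-from (0≤* (0≤fromℕ n) (0≤* 0≤h 0≤h))
        (solve 2 (λ h k → (:1 :+ h) :* (:1 :+ k :* h) :- (:1 :+ (:1 :+ k) :* h) := k :* (h :* h))
          refl h (fromℕ n)))
      (*-monoˡ-≤ (0≤+ 0≤1 0≤h) (bernoulli 0≤h n))

  module _ (em : ExcludedMiddle 0ℓ) where

    -- If the naturals were bounded, their supremum lowered by 1 would still bound them, since
    -- `suc n` is again a natural.
    archimedean : ∀ x → ∃ λ n → x ≤ fromℕ n
    archimedean x with em {∃ λ n → x ≤ fromℕ n}
    ... | yes ∃n = ∃n
    ... | no ∄n  = contradiction (proj₂ sup-least _ sup-1-bound) (<⇒≱ (x-y<x 0<1))
      where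
      naturals : Carrier → Set
      naturals y = ∃ λ n → y ≈ fromℕ n

      sup : ∃ (Supremum naturals)
      sup = complete naturals (0# , 0 , refl)
        (x , λ { y (n , y≈n) → ≤-trans (≈⇒≤ y≈n) (<⇒≤ (≰⇒> λ x≤n → ∄n (n , x≤n))) })

      sup-least = proj₂ sup

      sup-1-bound : UpperBound naturals (proj₁ sup - 1#)
      sup-1-bound y (n , y≈n) =
        ≤-from (x≤y⇒0≤y-x (proj₁ sup-least (fromℕ (suc n)) (suc n , refl)))
          (trans (+-congˡ (-‿cong y≈n))
            (solve 2 (λ s n → (s :- :1) :- n := s :- (:1 :+ n)) refl (proj₁ sup) (fromℕ n)))

    -- The bound `1# + x` is what limits the number of attempts in `blocks`.
    ceiling : ∀ {x} → 0# ≤ x → ∃ λ n → x ≤ fromℕ n × fromℕ n ≤ 1# + x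
    ceiling {x} 0≤x with archimedean x
    ... | n , x≤n = below n x≤n
      where
      below : ∀ n → x ≤ fromℕ n → ∃ λ n → x ≤ fromℕ n × fromℕ n ≤ 1# + x
      below zero    x≤0   = zero , x≤0 , 0≤+ 0≤1 0≤x
      below (suc n) x≤1+n with ≤-<-connex x (fromℕ n)
      ... | inj₁ x≤n = below n x≤n
      ... | inj₂ n<x = suc n , x≤1+n , +-mono-≤ ≤-refl (<⇒≤ n<x)

-- Increasing convex branches and their division by integer parts.

module Cylinders (em : ExcludedMiddle 0ℓ) (ℝ : CompleteOrderedField)
                 (s : CompleteOrderedField.Carrier ℝ) where
  open CompleteOrderedField ℝ hiding (zero)
  open RealAnalysis ℝ
  open OrderedFieldProperties ℝ

  -- `value` stands for T^n, or for q ↦ q T^n(q) minus an integer.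
  record Branch : Set where
    field
      left right      : Carrier
      value           : Carrier → Carrier
      -- A Lipschitz constant. It may grow with the number of digits, since it only supplies the
      -- continuity for `intermediateValue`.
      slope           : Carrier
      value-cong      : ∀ {x y} → x ≈ y → value x ≈ value y
      1≤left          : 1# ≤ left
      left<right      : left < right
      right≤s         : right ≤ s
      value-left      : value left ≈ 0#
      value-mono-<    : ∀ {x y} → left ≤ x → x < y → y ≤ right → value x < value y
      0<slope         : 0# < slope
      value-lipschitz : ∀ {x y} → left ≤ x → x ≤ y → y ≤ right →
                        value y - value x ≤ slope * (y - x)
      -- The chord inequality with its denominator `y - x` cleared, so that coinciding points need
      -- no separate case.
      value-convex    : ∀ {x y z} → left ≤ x → x ≤ z → z ≤ y → y ≤ right →
                        (y - x) * value z ≤ (y - z) * value x + (z - x) * value y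

    left≤right : left ≤ right
    left≤right = <⇒≤ left<right

    value-mono-≤ : ∀ {x y} → left ≤ x → x ≤ y → y ≤ right → value x ≤ value y
    value-mono-≤ l≤x (inj₁ x<y) y≤r = <⇒≤ (value-mono-< l≤x x<y y≤r)
    value-mono-≤ l≤x (inj₂ x≈y) y≤r = ≈⇒≤ (value-cong x≈y)

    0≤value : ∀ {x} → left ≤ x → x ≤ right → 0# ≤ value x
    0≤value l≤x x≤r = ≤-trans (≈⇒≤ (sym value-left)) (value-mono-≤ ≤-refl l≤x x≤r)

    -- Let `c` be the supremum of the points with value at most `v`. If its value differed from `v`,
    -- a step of length difference over `slope` could not cross `v`, which contradicts the choice of
    -- `c` from either side.
    intermediateValue : ∀ {v} → 0# ≤ v → v ≤ value right →
                        ∃ λ c → left ≤ c × c ≤ right × value c ≈ v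
    intermediateValue {v} 0≤v v≤vr = c , l≤c , c≤r , value-c
      where
      below : Carrier → Set
      below x = left ≤ x × x ≤ right × value x ≤ v

      below-left : below left
      below-left = ≤-refl , left≤right , ≤-trans (≈⇒≤ value-left) 0≤v

      sup : ∃ (Supremum below)
      sup = complete below (left , below-left) (right , λ x (_ , x≤r , _) → x≤r)

      c = proj₁ sup

      l≤c : left ≤ c
      l≤c = proj₁ (proj₂ sup) left below-left

      c≤r : c ≤ right
      c≤r = proj₂ (proj₂ sup) right λ x (_ , x≤r , _) → x≤r

      slope*step : ∀ y → slope * (y * slope ⁻¹) ≈ y
      slope*step y = trans (solve 3 (λ k y i → k :* (y :* i) := k :* i :* y) refl slope y (slope ⁻¹))
                       (trans (*-congʳ (*-inverseʳ-pos 0<slope)) (*-identityˡ y))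

      value-c : value c ≈ v
      value-c with compare (value c) v
      ... | tri≈ _ vc≈v _ = vc≈v
      ... | tri< vc<v _ _ = not-sup (≤-<-connex (c + step) right)
        where
        step = (v - value c) * slope ⁻¹

        0<step : 0# < step
        0<step = *-pos (x<y⇒0<y-x vc<v) (⁻¹-pos 0<slope)

        still-below : ∀ {y} → c ≤ y → y ≤ c + step → y ≤ right → below y
        still-below {y} c≤y y≤c+step y≤r = ≤-trans l≤c c≤y , y≤r ,
          ≤-from (0≤+ (x≤y⇒0≤y-x (value-lipschitz l≤c c≤y y≤r))
                      (0≤* (<⇒≤ 0<slope) (x≤y⇒0≤y-x y≤c+step)))
            (trans (+-congʳ (trans (solve 2 (λ v w → v := w :+ (v :- w)) refl v (value c))
                                   (+-congˡ (sym (slope*step (v - value c))))))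
              (solve 6 (λ k y c e w u → w :+ k :* e :- u :=
                          (k :* (y :- c) :- (u :- w)) :+ k :* ((c :+ e) :- y))
                refl slope y c step (value c) (value y)))

        c<r : c < right
        c<r = ≰⇒> λ r≤c → <⇒≱ vc<v (≤-trans v≤vr (value-mono-≤ left≤right r≤c c≤r))

        -- If the step overshoots `right`, then `right` itself belongs to `below`, and it lies
        -- beyond `c` because `v ≤ value right`.
        not-sup : c + step ≤ right ⊎ right < c + step → value c ≈ v
        not-sup (inj₁ c+step≤r) = contradiction
          (proj₁ (proj₂ sup) _ (still-below (x≤x+y (<⇒≤ 0<step)) ≤-refl c+step≤r))
          (<⇒≱ (x<x+y 0<step))
        not-sup (inj₂ r<c+step) = contradiction
          (proj₁ (proj₂ sup) _ (still-below c≤r (<⇒≤ r<c+step) ≤-refl))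
          (<⇒≱ c<r)
      ... | tri> _ _ v<vc = contradiction (proj₂ (proj₂ sup) _ lower) (<⇒≱ (x-y<x 0<step))
        where
        step = (value c - v) * slope ⁻¹

        0<step : 0# < step
        0<step = *-pos (x<y⇒0<y-x v<vc) (⁻¹-pos 0<slope)

        lower : UpperBound below (c - step)
        lower x (l≤x , x≤r , vx≤v) = ≮⇒≥ λ c-step<x → <⇒≱
          (<-from (0<+ (*-pos 0<slope (x<y⇒0<y-x c-step<x))
                       (x≤y⇒0≤y-x (value-lipschitz l≤x (proj₁ (proj₂ sup) x (l≤x , x≤r , vx≤v)) c≤r)))
            (trans (+-congˡ (-‿cong (trans
                (solve 2 (λ v w → v := w :- (w :- v)) refl v (value c))
                (+-congˡ (-‿cong (sym (slope*step (value c - v))))))))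
              (solve 6 (λ k x c e w u → u :- (w :- k :* e) :=
                          k :* (x :- (c :- e)) :+ (k :* (c :- x) :- (w :- u)))
                refl slope x c step (value c) (value x))))
          vx≤v

  restrict : ∀ B {c} → Branch.left B < c → c ≤ Branch.right B → Branch
  restrict B {c} l<c c≤r = record
    { left            = left
    ; right           = c
    ; value           = value
    ; slope           = slope
    ; value-cong      = value-cong
    ; 1≤left          = 1≤left
    ; left<right      = l<c
    ; right≤s         = ≤-trans c≤r right≤s
    ; value-left      = value-left
    ; value-mono-<    = λ l≤x x<y y≤c → value-mono-< l≤x x<y (≤-trans y≤c c≤r)
    ; 0<slope         = 0<slope
    ; value-lipschitz = λ l≤x x≤y y≤c → value-lipschitz l≤x x≤y (≤-trans y≤c c≤r)
    ; value-convex    = λ l≤x x≤z z≤y y≤c → value-convex l≤x x≤z z≤y (≤-trans y≤c c≤r)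
    }
    where open Branch B

  -- Beyond the point where the value reaches 1, subtracting 1 gives a branch that starts at 0
  -- again; repeating this peels off the integer part.
  lower : ∀ B {c} → Branch.left B ≤ c → c < Branch.right B → Branch.value B c ≈ 1# → Branch
  lower B {c} l≤c c<r vc≈1 = record
    { left            = c
    ; right           = right
    ; value           = λ x → value x - 1#
    ; slope           = slope
    ; value-cong      = λ x≈y → +-congʳ (value-cong x≈y)
    ; 1≤left          = ≤-trans 1≤left l≤c
    ; left<right      = c<r
    ; right≤s         = right≤s
    ; value-left      = trans (+-congʳ vc≈1) (-‿inverseʳ 1#)
    ; value-mono-<    = λ c≤x x<y y≤r → +-monoˡ-< (- 1#) (value-mono-< (≤-trans l≤c c≤x) x<y y≤r)
    ; 0<slope         = 0<slope
    ; value-lipschitz = λ {x} {y} c≤x x≤y y≤r → ≤-trans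
        (≈⇒≤ (solve 2 (λ u v → (v :- :1) :- (u :- :1) := v :- u) refl (value x) (value y)))
        (value-lipschitz (≤-trans l≤c c≤x) x≤y y≤r)
    ; value-convex    = λ {x} {y} {z} c≤x x≤z z≤y y≤r → ≤-from
        (x≤y⇒0≤y-x (value-convex (≤-trans l≤c c≤x) x≤z z≤y y≤r))
        (solve 6 (λ x y z u v w →
            ((y :- z) :* (u :- :1) :+ (z :- x) :* (v :- :1)) :- (y :- x) :* (w :- :1) :=
            ((y :- z) :* u :+ (z :- x) :* v) :- (y :- x) :* w)
          refl x y z (value x) (value y) (value z))
    }
    where open Branch B

  record Cylinder : Set where
    field
      branch        : Branch
      value-right≤1 : Branch.value branch (Branch.right branch) ≤ 1#
    open Branch branch public

    value≤1 : ∀ {x} → left ≤ x → x ≤ right → value x ≤ 1#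
    value≤1 l≤x x≤r = ≤-trans (value-mono-≤ l≤x x≤r ≤-refl) value-right≤1

  open Cylinder

  -- The fields survive multiplication by `x` because both factors are nonnegative and increasing.
  -- For values `u` at `x` and `v` at `y`, the new slope comes from
  -- `y v - x u = y (v - u) + (y - x) u` with `y ≤ s` and `u ≤ 1`.
  advance : Cylinder → Branch
  advance C = record
    { left            = left C
    ; right           = right C
    ; value           = λ x → x * value C x
    ; slope           = s * slope C + 1#
    ; value-cong      = λ x≈y → *-cong x≈y (value-cong C x≈y)
    ; 1≤left          = 1≤left C
    ; left<right      = left<right C
    ; right≤s         = right≤s C
    ; value-left      = trans (*-congˡ (value-left C)) (zeroʳ (left C))
    ; value-mono-<    = λ {x} {y} l≤x x<y y≤r → ≤-<-trans
        (*-monoʳ-≤ (0≤value C l≤x (≤-trans (<⇒≤ x<y) y≤r)) (<⇒≤ x<y))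
        (*-monoˡ-< (<-trans (0<x l≤x) x<y) (value-mono-< C l≤x x<y y≤r))
    ; 0<slope         = ≤-<-trans
        (0≤* (≤-trans (<⇒≤ (0<x (left≤right C))) (right≤s C)) (<⇒≤ (0<slope C))) (x<x+y 0<1)
    ; value-lipschitz = λ {x} {y} l≤x x≤y y≤r → ≤-from
        (0≤+ (0≤+ (0≤* (0≤* (x≤y⇒0≤y-x (≤-trans y≤r (right≤s C))) (<⇒≤ (0<slope C)))
                       (x≤y⇒0≤y-x x≤y))
                  (0≤* (≤-trans (<⇒≤ (0<x l≤x)) x≤y)
                       (x≤y⇒0≤y-x (value-lipschitz C l≤x x≤y y≤r))))
             (0≤* (x≤y⇒0≤y-x x≤y) (x≤y⇒0≤y-x (value≤1 C l≤x (≤-trans x≤y y≤r)))))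
        (solve 6 (λ s k x y u v →
            (s :* k :+ :1) :* (y :- x) :- (y :* v :- x :* u) :=
            ((s :- y) :* k :* (y :- x) :+ y :* (k :* (y :- x) :- (v :- u))) :+ (y :- x) :* (:1 :- u))
          refl s (slope C) x y (value C x) (value C y))
    -- The gap in the new chord inequality is `z` times the gap for `C` plus
    -- `(y - z) (z - x) (v - u)`, nonnegative by monotonicity.
    ; value-convex    = λ {x} {y} {z} l≤x x≤z z≤y y≤r → ≤-from
        (0≤+ (0≤* (≤-trans (<⇒≤ (0<x l≤x)) x≤z)
                  (x≤y⇒0≤y-x (value-convex C l≤x x≤z z≤y y≤r)))
             (0≤* (0≤* (x≤y⇒0≤y-x z≤y) (x≤y⇒0≤y-x x≤z))
                  (x≤y⇒0≤y-x (value-mono-≤ C l≤x (≤-trans x≤z z≤y) y≤r))))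
        (solve 6 (λ x y z u v w →
            ((y :- z) :* (x :* u) :+ (z :- x) :* (y :* v)) :- (y :- x) :* (z :* w) :=
            z :* (((y :- z) :* u :+ (z :- x) :* v) :- (y :- x) :* w)
              :+ (y :- z) :* (z :- x) :* (v :- u))
          refl x y z (value C x) (value C y) (value C z))
    }
    where
    0<x : ∀ {x} → left C ≤ x → 0# < x
    0<x l≤x = <-≤-trans 0<1 (≤-trans (1≤left C) l≤x)

  length : Cylinder → Carrier
  length C = right C - left C

  total : List Cylinder → Carrier
  total []       = 0#
  total (C ∷ Cs) = length C + total Cs

  total-++ : ∀ Cs Ds → total (Cs ++ Ds) ≈ total Cs + total Ds
  total-++ []       Ds = sym (+-identityˡ _)
  total-++ (C ∷ Cs) Ds = trans (+-congˡ (total-++ Cs Ds)) (sym (+-assoc _ _ _))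

  -- Half-open, because at the right end the value can be 1, which belongs to the piece of the next
  -- larger digit.
  record Contains (x v : Carrier) (C : Cylinder) : Set where
    constructor contains
    field
      left≤x   : left C ≤ x
      x<right  : x < right C
      value-x  : value C x ≈ v

  Contains-resp : ∀ {x v w C} → v ≈ w → Contains x v C → Contains x w C
  Contains-resp v≈w (contains l≤x x<r value≈v) = contains l≤x x<r (trans value≈v v≈w)

  -- The pieces of a branch on which the integer part of its value is constant;
  -- `first` is the piece for 0 and `rest` lists the pieces for 1, 2, ….
  record Splitting (B : Branch) : Set where
    private module B = Branch B
    field
      first       : Cylinder
      rest        : List Cylinder
      first-left  : left first ≈ B.left
      first-value : ∀ x → value first x ≈ B.value x
      -- This keeps the point `z` of `escapes-total` inside the piece for 0.
      first-max   : ∀ {x} → B.left ≤ x → x ≤ B.right → B.value x ≤ 1# → x ≤ right first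
      rest-total  : total rest ≈ B.right - right first
      first-cover : ∀ {x} → B.left ≤ x → x < B.right → B.value x < 1# →
                    Contains x (B.value x) first
      rest-cover  : ∀ {x} → B.left ≤ x → x < B.right → ∀ d →
                    0# ≤ B.value x - fromℕ (suc d) → B.value x - fromℕ (suc d) < 1# →
                    Any (Contains x (B.value x - fromℕ (suc d))) rest

  -- Induction on an integer bound for the value at the right end: cut where the value reaches 1 and
  -- treat what follows, lowered by 1. A value of exactly 1 at the right end makes no cut, so every
  -- piece has positive length.
  split : ∀ n B → Branch.value B (Branch.right B) ≤ fromℕ n → Splitting B
  split n B vr≤n with ≤-<-connex (Branch.value B (Branch.right B)) 1#
  ... | inj₁ vr≤1 = record
    { first       = record { branch = B ; value-right≤1 = vr≤1 }
    ; rest        = []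
    ; first-left  = refl
    ; first-value = λ _ → refl
    ; first-max   = λ _ x≤r _ → x≤r
    ; rest-total  = sym (-‿inverseʳ _)
    ; first-cover = λ l≤x x<r _ → contains l≤x x<r refl
    ; rest-cover  = λ {x} l≤x x<r d 0≤v-d _ → contradiction
        (0≤x-fromℕ-suc⇒1≤x d 0≤v-d)
        (<⇒≱ (<-≤-trans (Branch.value-mono-< B l≤x x<r ≤-refl) vr≤1))
    }
  split zero    B vr≤n | inj₂ 1<vr = contradiction vr≤n (<⇒≱ (<-trans 0<1 1<vr))
  split (suc n) B vr≤n | inj₂ 1<vr = record
    { first       = record { branch = restrict B l<c c≤r ; value-right≤1 = ≈⇒≤ vc≈1 }
    ; rest        = T.first ∷ T.rest
    ; first-left  = refl
    ; first-value = λ _ → refl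
    ; first-max   = λ l≤x x≤r vx≤1 → ≮⇒≥ λ c<x →
        <⇒≱ (<-respˡ-≈ vc≈1 (B.value-mono-< l≤c c<x x≤r)) vx≤1
    ; rest-total  = trans (+-cong (+-congˡ (-‿cong T.first-left)) T.rest-total)
        (solve 3 (λ c r f → (f :- c) :+ (r :- f) := r :- c) refl c B.right (Cylinder.right T.first))
    ; first-cover = λ l≤x x<r vx<1 → contains l≤x
        (≰⇒> λ c≤x → <⇒≱ vx<1 (≤-trans (≈⇒≤ (sym vc≈1)) (B.value-mono-≤ l≤c c≤x (<⇒≤ x<r)))) refl
    ; rest-cover  = cover
    }
    where
    module B = Branch B
    ivt = B.intermediateValue 0≤1 (<⇒≤ 1<vr)
    c    = proj₁ ivt
    l≤c  = proj₁ (proj₂ ivt)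
    c≤r  = proj₁ (proj₂ (proj₂ ivt))
    vc≈1 = proj₂ (proj₂ (proj₂ ivt))

    l<c : B.left < c
    l<c = ≰⇒> λ c≤l → <⇒≱ 0<1 (≤-trans (≈⇒≤ (sym vc≈1))
      (≤-trans (B.value-mono-≤ l≤c c≤l B.left≤right) (≈⇒≤ B.value-left)))

    c<r : c < B.right
    c<r = ≰⇒> λ r≤c → <⇒≱ 1<vr (≤-trans (B.value-mono-≤ B.left≤right r≤c c≤r) (≈⇒≤ vc≈1))

    module T = Splitting (split n (lower B l≤c c<r vc≈1)
      (≤-from (x≤y⇒0≤y-x vr≤n)
        (solve 2 (λ v n → n :- (v :- :1) := (:1 :+ n) :- v) refl (B.value B.right) (fromℕ n))))

    cover : ∀ {x} → B.left ≤ x → x < B.right → ∀ d →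
            0# ≤ B.value x - fromℕ (suc d) → B.value x - fromℕ (suc d) < 1# →
            Any (Contains x (B.value x - fromℕ (suc d))) (T.first ∷ T.rest)
    cover {x} l≤x x<r d 0≤v-d v-d<1 = cover-from d 0≤v-d v-d<1
      where
      c≤x : c ≤ x
      c≤x = ≮⇒≥ λ x<c → <⇒≱ (B.value-mono-< l≤x x<c c≤r) (≤-trans (≈⇒≤ vc≈1)
        (0≤x-fromℕ-suc⇒1≤x d 0≤v-d))

      recentre : ∀ d → B.value x - 1# - fromℕ d ≈ B.value x - fromℕ (suc d)
      recentre d = solve 2 (λ v d → v :- :1 :- d := v :- (:1 :+ d)) refl (B.value x) (fromℕ d)

      cover-from : ∀ d → 0# ≤ B.value x - fromℕ (suc d) → B.value x - fromℕ (suc d) < 1# →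
                   Any (Contains x (B.value x - fromℕ (suc d))) (T.first ∷ T.rest)
      cover-from zero _ v-1<1 = here (Contains-resp v-1≈ (T.first-cover c≤x x<r
        (<-respˡ-≈ (sym v-1≈) v-1<1)))
        where
        v-1≈ : B.value x - 1# ≈ B.value x - fromℕ 1
        v-1≈ = +-congˡ (-‿cong (sym fromℕ-1))
      cover-from (suc d) 0≤v-d v-d<1 = there (Any.map (Contains-resp (recentre (suc d)))
        (T.rest-cover c≤x x<r d (≤-trans 0≤v-d (≈⇒≤ (sym (recentre (suc d)))))
          (<-respˡ-≈ (sym (recentre (suc d))) v-d<1)))

-- Digit sequences and partial sums.

firstDifference : ExcludedMiddle 0ℓ → ∀ {k} (c d : ℕ → Fin k) →
  (∀ i → c i ≡ d i) ⊎ ∃ λ n → (∀ i → i ℕ.< n → c i ≡ d i) × c n ≢ d n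
firstDifference em c d with em {∃ λ n → (∀ i → i ℕ.< n → c i ≡ d i) × c n ≢ d n}
... | yes ∃n = inj₂ ∃n
-- Agreement below `i` forces agreement at `i`, as otherwise `i` would be a first difference.
... | no ∄n  = inj₁ (<-rec _ λ i same →
  decidable-stable (c i Fin.≟ d i) λ ci≢di → ∄n (i , (λ j → same {j}) , ci≢di))

module PartialSums (ℝ : CompleteOrderedField) where
  open CompleteOrderedField ℝ hiding (zero)
  open RealAnalysis ℝ
  open OrderedFieldProperties ℝ

  partialSum-suc : ∀ f n → partialSum f (suc n) ≈ partialSum f n + f n
  partialSum-suc f zero    = +-comm _ _
  partialSum-suc f (suc n) = trans (+-congˡ (partialSum-suc (f ∘ suc) n)) (sym (+-assoc _ _ _))

  partialSum-cong-< : ∀ {f g} n → (∀ i → i ℕ.< n → f i ≈ g i) → partialSum f n ≈ partialSum g n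
  partialSum-cong-< zero    f≈g = refl
  partialSum-cong-< (suc n) f≈g =
    +-cong (f≈g 0 ℕ.z<s) (partialSum-cong-< n λ i i<n → f≈g (suc i) (ℕ.s<s i<n))

  partialSum-mono-≤ : ∀ {f} → (∀ i → 0# ≤ f i) → ∀ {m n} → m ℕ.≤ n → partialSum f m ≤ partialSum f n
  partialSum-mono-≤ 0≤f {n = zero}  ℕ.z≤n = ≤-refl
  partialSum-mono-≤ 0≤f {n = suc n} ℕ.z≤n = 0≤+ (0≤f 0) (partialSum-mono-≤ (0≤f ∘ suc) {n = n} ℕ.z≤n)
  partialSum-mono-≤ 0≤f (ℕ.s≤s m≤n) = +-mono-≤ ≤-refl (partialSum-mono-≤ (0≤f ∘ suc) m≤n)

-- The greedy algorithm computes the largest expansion of 1.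

module Greedy (ℝ : CompleteOrderedField) (M : ℕ) (q : CompleteOrderedField.Carrier ℝ) where
  open CompleteOrderedField ℝ hiding (zero)
  open RealAnalysis ℝ
  open OrderedFieldProperties ℝ
  open PartialSums ℝ

  -- For `y` in `[0, M + 1)` this is the integer part; other arguments receive default values.
  floorDigit : ∀ M → Carrier → Fin (suc M)
  floorDigit zero    y = Fin.zero
  floorDigit (suc M) y with y <? 1#
  ... | yes _ = Fin.zero
  ... | no  _ = Fin.suc (floorDigit M (y - 1#))

  floorDigit-spec : ∀ M {y} → 0# ≤ y → y < fromℕ (suc M) →
    0# ≤ y - fromℕ (toℕ (floorDigit M y)) × y - fromℕ (toℕ (floorDigit M y)) < 1#
  floorDigit-spec zero {y} 0≤y y<1 =
    ≤-trans 0≤y (≈⇒≤ (sym (x-0≈x y))) , <-respˡ-≈ (sym (x-0≈x y)) (<-respʳ-≈ fromℕ-1 y<1)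
  floorDigit-spec (suc M) {y} 0≤y y<2+M with y <? 1#
  ... | yes y<1 = ≤-trans 0≤y (≈⇒≤ (sym (x-0≈x y))) , <-respˡ-≈ (sym (x-0≈x y)) y<1
  ... | no y≮1 = ≤-trans (proj₁ ih) (≈⇒≤ shift) , <-respˡ-≈ shift (proj₂ ih)
    where
    ih = floorDigit-spec M (x≤y⇒0≤y-x (≮⇒≥ y≮1))
      (<-from (x<y⇒0<y-x y<2+M)
        (solve 2 (λ n y → n :- (y :- :1) := (:1 :+ n) :- y) refl (fromℕ (suc M)) y))
    shift : y - 1# - fromℕ (toℕ (floorDigit M (y - 1#))) ≈ y - (1# + fromℕ (toℕ (floorDigit M (y - 1#))))
    shift = solve 2 (λ y d → y :- :1 :- d := y :- (:1 :+ d)) refl y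
              (fromℕ (toℕ (floorDigit M (y - 1#))))

  remainder : ℕ → Carrier
  remainder zero    = 1#
  remainder (suc n) = q * remainder n - fromℕ (toℕ (floorDigit M (q * remainder n)))

  digit : DigitSeq {M}
  digit n = floorDigit M (q * remainder n)

  module _ (1<q : 1# < q) (q<1+M : q < fromℕ (suc M)) where

    private
      0<q : 0# < q
      0<q = <-trans 0<1 1<q

    mutual
      -- The remainder starts at exactly 1, so strictness begins only after one digit; `q < M + 1`
      -- makes even `q * 1#` small enough for a digit.
      remainder-suc-bounds : ∀ n → 0# ≤ remainder (suc n) × remainder (suc n) < 1#
      remainder-suc-bounds n = floorDigit-spec M (0≤* (<⇒≤ 0<q) (proj₁ (remainder-bounds n)))
        (≤-<-trans (≤-trans (*-monoˡ-≤ (<⇒≤ 0<q) (proj₂ (remainder-bounds n))) (≈⇒≤ (*-identityʳ q)))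
          q<1+M)

      remainder-bounds : ∀ n → 0# ≤ remainder n × remainder n ≤ 1#
      remainder-bounds zero    = 0≤1 , ≤-refl
      remainder-bounds (suc n) = proj₁ (remainder-suc-bounds n) , <⇒≤ (proj₂ (remainder-suc-bounds n))

    private
      p = q ⁻¹

      0<p : 0# < p
      0<p = ⁻¹-pos 0<q

      q^*p^ : ∀ n → q ^ n * p ^ n ≈ 1#
      q^*p^ n = trans (sym (^-distrib-* q p n)) (trans (^-congˡ n (*-inverseʳ-pos 0<q)) (1^ n))

      term : DigitSeq {M} → ℕ → Carrier
      term c i = fromℕ (toℕ (c i)) * p ^ suc i

      0≤term : ∀ c i → 0# ≤ term c i
      0≤term c i = 0≤* (0≤fromℕ (toℕ (c i))) (<⇒≤ (^-pos 0<p (suc i)))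

    -- Undoing the factors `q` one at a time turns the recursion of `remainder` into the subtraction
    -- of the terms of the series.
    1-partialSum : ∀ n → 1# - partialSum (term digit) n ≈ remainder n * p ^ n
    1-partialSum zero    = solve 0 (:1 :- :0 := :1 :* :1) refl
    1-partialSum (suc n) = begin
      1# - partialSum (term digit) (suc n)
        ≈⟨ +-congˡ (-‿cong (partialSum-suc (term digit) n)) ⟩
      1# - (partialSum (term digit) n + d * (p * p ^ n))
        ≈⟨ solve 2 (λ P t → :1 :- (P :+ t) := :1 :- P :- t) refl _ _ ⟩
      1# - partialSum (term digit) n - d * (p * p ^ n)
        ≈⟨ +-congʳ (trans (1-partialSum n) (sym (*-identityˡ _))) ⟩
      1# * (remainder n * p ^ n) - d * (p * p ^ n)
        ≈⟨ +-congʳ (*-congʳ (*-inverseʳ-pos 0<q)) ⟨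
      q * p * (remainder n * p ^ n) - d * (p * p ^ n)
        ≈⟨ solve 5 (λ q p t e d → q :* p :* (t :* e) :- d :* (p :* e) := (q :* t :- d) :* (p :* e))
             refl q p (remainder n) (p ^ n) d ⟩
      remainder (suc n) * p ^ suc n ∎
      where
      open SetoidReasoning setoid
      d = fromℕ (toℕ (digit n))

    module _ (em : ExcludedMiddle 0ℓ) where

      -- Bernoulli's inequality for `q ^ n`, with `N` taken so that `N (q - 1)` is at least the
      -- inverse of `ε`.
      p^→0 : ∀ {ε} → 0# < ε → ∃ λ N → ∀ n → N ℕ.≤ n → p ^ n < ε
      p^→0 {ε} 0<ε with archimedean em (ε ⁻¹ * (q - 1#) ⁻¹)
      ... | N , ε⁻¹h⁻¹≤N = N , λ n N≤n →
        <-respˡ-≈ (trans (*-congˡ (*-inverseʳ-pos 0<ε)) (*-identityʳ (p ^ n)))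
          (<-respʳ-≈ (trans (solve 3 (λ a b e → a :* (e :* b) := b :* a :* e) refl (p ^ n) (q ^ n) ε)
                            (trans (*-congʳ (q^*p^ n)) (*-identityˡ ε)))
            (*-monoˡ-< (^-pos 0<p n) (*-monoˡ-< 0<ε (ε⁻¹<q^ n N≤n))))
        where
        0<h : 0# < q - 1#
        0<h = x<y⇒0<y-x 1<q

        ε⁻¹<q^ : ∀ n → N ℕ.≤ n → ε ⁻¹ < q ^ n
        ε⁻¹<q^ n N≤n = <-≤-trans (≤-<-trans
            (≤-trans (≈⇒≤ (trans (sym (*-identityʳ _)) (trans
                (*-congˡ (sym (*-inverseʳ-pos 0<h)))
                (solve 3 (λ e h i → e :* (h :* i) := e :* i :* h) refl (ε ⁻¹) (q - 1#) ((q - 1#) ⁻¹)))))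
              (*-monoʳ-≤ (<⇒≤ 0<h) (≤-trans ε⁻¹h⁻¹≤N (fromℕ-mono-≤ N≤n))))
            (<-respʳ-≈ (+-comm _ _) (x<x+y 0<1)))
          (≤-trans (bernoulli (<⇒≤ 0<h) n)
            (≈⇒≤ (^-congˡ n (solve 1 (λ q → :1 :+ (q :- :1) := q) refl q))))

      digit-isExpansion : IsExpansion q 1# digit
      digit-isExpansion ε 0<ε = proj₁ (p^→0 0<ε) , λ n N≤n → close-to-1 0<ε (1-partialSum n)
        (0≤* (proj₁ (remainder-bounds n)) (<⇒≤ (^-pos 0<p n)))
        (≤-<-trans (≤-trans (*-monoʳ-≤ (<⇒≤ (^-pos 0<p n)) (proj₂ (remainder-bounds n)))
            (≈⇒≤ (*-identityˡ (p ^ n)))) (proj₂ (p^→0 0<ε) n N≤n))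
        where
        close-to-1 : ∀ {P t ε} → 0# < ε → 1# - P ≈ t → 0# ≤ t → t < ε → 1# - ε < P × P < 1# + ε
        close-to-1 {P} {t} {ε} 0<ε 1-P≈t 0≤t t<ε =
          <-from (x<y⇒0<y-x t<ε)
            (trans (solve 2 (λ P e → P :- (:1 :- e) := e :- (:1 :- P)) refl P ε)
                   (+-congˡ (-‿cong 1-P≈t))) ,
          <-from (0<+ 0<ε 0≤t)
            (trans (solve 2 (λ P e → (:1 :+ e) :- P := e :+ (:1 :- P)) refl P ε) (+-congˡ 1-P≈t))

      -- At index `n` the sequence `d` gains at least `p ^ suc n`, whereas the greedy sum falls
      -- short of 1 by `remainder (suc n) * p ^ suc n`, which is less. So a partial sum of `d`
      -- exceeds 1, and the later terms are nonnegative.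
      larger-not-expansion : ∀ d n → (∀ i → i ℕ.< n → d i ≡ digit i) → digit n Fin.< d n →
                             ¬ IsExpansion q 1# d
      larger-not-expansion d n same β<d expansion =
        <⇒≱ (proj₂ (proj₂ limit (N ℕ.⊔ suc n) (ℕ.m≤m⊔n N (suc n))))
          (≤-trans (≈⇒≤ (cancel (partialSum (term d) (suc n))))
            (partialSum-mono-≤ (0≤term d) (ℕ.m≤n⊔m N (suc n))))
        where
        cancel : ∀ D → 1# + (D - 1#) ≈ D
        cancel = solve 1 (λ D → :1 :+ (D :- :1) := D) refl

        1<Dₙ₊₁ : 1# < partialSum (term d) (suc n)
        1<Dₙ₊₁ = exceeds-1 {b = fromℕ (toℕ (digit n))} {x = fromℕ (toℕ (d n))}
          (sym (partialSum-suc (term d) n)) prefix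
          (trans (+-congˡ (-‿cong (sym (partialSum-suc (term digit) n)))) (1-partialSum (suc n)))
          (^-pos 0<p (suc n)) (proj₂ (remainder-suc-bounds n)) (fromℕ-mono-≤ β<d)
          where
          prefix : partialSum (term d) n ≈ partialSum (term digit) n
          prefix = partialSum-cong-< n λ i i<n →
            reflexive (≡.cong (λ c → fromℕ (toℕ c) * p ^ suc i) (same i i<n))

          exceeds-1 : ∀ {D D′ P b x e t} → D′ + x * e ≈ D → D′ ≈ P → 1# - (P + b * e) ≈ t * e →
                      0# < e → t < 1# → 1# + b ≤ x → 1# < D
          exceeds-1 {D} {D′} {P} {b} {x} {e} {t} D′+xe≈D D′≈P gap 0<e t<1 1+b≤x =
            <-respʳ-≈ D′+xe≈D (<-from
              (0<+ (x<y⇒0<y-x (*-monoʳ-< 0<e t<1)) (0≤* (x≤y⇒0≤y-x 1+b≤x) (<⇒≤ 0<e)))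
              (trans (+-congʳ (+-congʳ D′≈P))
                (trans (solve 4 (λ P x b e → (P :+ x :* e) :- :1 :=
                           (:1 :* e :- (:1 :- (P :+ b :* e))) :+ (x :- (:1 :+ b)) :* e)
                         refl P x b e)
                  (+-congʳ (+-congˡ (-‿cong gap))))))

        -- With the excess over 1 as tolerance, late partial sums would have to lie strictly below
        -- this one.
        limit = expansion (partialSum (term d) (suc n) - 1#) (x<y⇒0<y-x 1<Dₙ₊₁)
        N     = proj₁ limit

      digit-isGreedy : IsGreedyExpansion q 1# digit
      digit-isGreedy = digit-isExpansion , largest
        where
        largest : ∀ d → IsExpansion q 1# d → d ≤lex digit
        largest d expansion with firstDifference em d digit
        ... | inj₁ same = inj₁ same
        ... | inj₂ (n , same , dn≢βn) with Fin.<-cmp (d n) (digit n)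
        ...   | tri< dn<βn _ _ = inj₂ (n , same , dn<βn)
        ...   | tri≈ _ dn≡βn _ = contradiction dn≡βn dn≢βn
        ...   | tri> _ _ βn<dn = contradiction expansion (larger-not-expansion d n same βn<dn)

-- Cylinders left over by repeated attempts at a zero run.

module Subdivision (em : ExcludedMiddle 0ℓ) (ℝ : CompleteOrderedField)
                   (s : CompleteOrderedField.Carrier ℝ) (M : ℕ)
                   (1<s : CompleteOrderedField._<_ ℝ (CompleteOrderedField.1# ℝ) s)
                   (s≤1+M : CompleteOrderedField._≤_ ℝ s (RealAnalysis.fromℕ ℝ (suc M))) where
  open CompleteOrderedField ℝ hiding (zero)
  open RealAnalysis ℝ
  open OrderedFieldProperties ℝ
  open Cylinders em ℝ s
  open Cylinder using (left; right; value; left≤right; 1≤left; right≤s; value-left; value-right≤1;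
                       value-convex; 0≤value; left<right)

  0<s : 0# < s
  0<s = <-trans 0<1 1<s

  -- Since β_1 ≥ 1, the functions T^1(q) = q - β_1 arise by splitting q - 1.
  root : Branch
  root = record
    { left            = 1#
    ; right           = s
    ; value           = λ x → x - 1#
    ; slope           = 1#
    ; value-cong      = +-congʳ
    ; 1≤left          = ≤-refl
    ; left<right      = 1<s
    ; right≤s         = ≤-refl
    ; value-left      = -‿inverseʳ 1#
    ; value-mono-<    = λ _ x<y _ → +-monoˡ-< (- 1#) x<y
    ; 0<slope         = 0<1
    ; value-lipschitz = λ {x} {y} _ _ _ →
        ≈⇒≤ (solve 2 (λ x y → (y :- :1) :- (x :- :1) := :1 :* (y :- x)) refl x y)
    ; value-convex    = λ {x} {y} {z} _ _ _ _ → ≈⇒≤ (solve 3 (λ x y z →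
        (y :- x) :* (z :- :1) := (y :- z) :* (x :- :1) :+ (z :- x) :* (y :- :1)) refl x y z)
    }

  rootSplitting : Splitting root
  rootSplitting = split (suc M) root (≤-trans (x-y≤x 0≤1) s≤1+M)

  splitting : ∀ C → Splitting (advance C)
  splitting C = split (suc M) (advance C)
    (≤-trans (*-monoˡ-≤ (≤-trans 0≤1 (≤-trans (1≤left C) (left≤right C))) (value-right≤1 C))
      (≤-trans (≈⇒≤ (*-identityʳ (right C))) (≤-trans (right≤s C) s≤1+M)))

  open Splitting

  pieces : ∀ {B} → Splitting B → List Cylinder
  pieces S = first S ∷ rest S

  pieces-total : ∀ {B} (S : Splitting B) → total (pieces S) ≈ Branch.right B - Branch.left B
  pieces-total {B} S = trans (+-cong (+-congˡ (-‿cong (first-left S))) (rest-total S))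
    (solve 3 (λ f l r → (f :- l) :+ (r :- f) := r :- l) refl (right (first S)) (Branch.left B) (Branch.right B))

  -- The digit 0 is kept apart because only the first piece continues a run of zeros.
  pieces-cover : ∀ {B} (S : Splitting B) {x} → Branch.left B ≤ x → x < Branch.right B → ∀ d →
    0# ≤ Branch.value B x - fromℕ d → Branch.value B x - fromℕ d < 1# →
    d ≡ 0 × Contains x (Branch.value B x - fromℕ d) (first S) ⊎
    Any (Contains x (Branch.value B x - fromℕ d)) (rest S)
  pieces-cover {B} S {x} l≤x x<r zero _ v<1 = inj₁ (≡.refl , Contains-resp (sym v-0≈v)
      (first-cover S l≤x x<r (<-respˡ-≈ v-0≈v v<1)))
    where
    v-0≈v = x-0≈x (Branch.value B x)
  pieces-cover S l≤x x<r (suc d) 0≤v-d v-d<1 = inj₂ (rest-cover S l≤x x<r d 0≤v-d v-d<1)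

  children : Cylinder → List Cylinder
  children C = pieces (splitting C)

  -- The cylinders inside C on which the next k digits are not all zero, each
  -- ending at the first nonzero digit.
  escapes : ℕ → Cylinder → List Cylinder
  escapes zero    C = []
  escapes (suc k) C = rest (splitting C) ++ escapes k (first (splitting C))

  -- Since `z ≥ 1`, the bound on `z ^ k * value C z` keeps `z` in the piece for 0 through all `k`
  -- digits. The escaping pieces therefore lie to the right of `z`, and their lengths telescope.
  escapes-total : ∀ k C {z} → left C ≤ z → z ≤ right C → z ^ k * value C z ≤ 1# →
                  total (escapes k C) ≤ right C - z
  escapes-total zero    C l≤z z≤r _ = x≤y⇒0≤y-x z≤r
  escapes-total (suc k) C {z} l≤z z≤r z^*v≤1 = ≤-trans
      (≤-trans (≈⇒≤ (total-++ (rest S) (escapes k (first S))))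
        (+-mono-≤ (≈⇒≤ (rest-total S))
          (escapes-total k (first S) (≤-trans (≈⇒≤ (first-left S)) l≤z) z≤first
            (≤-trans (≈⇒≤ (*-congˡ (first-value S z))) z^*zv≤1))))
      (≈⇒≤ (solve 3 (λ r f z → (r :- f) :+ (f :- z) := r :- z) refl (right C) (right (first S)) z))
    where
    S = splitting C

    1≤z : 1# ≤ z
    1≤z = ≤-trans (1≤left C) l≤z

    z^*zv≤1 : z ^ k * (z * value C z) ≤ 1#
    z^*zv≤1 = ≤-trans (≈⇒≤ (solve 3 (λ a z v → a :* (z :* v) := z :* a :* v) refl (z ^ k) z (value C z)))
      z^*v≤1

    z≤first : z ≤ right (first S)
    z≤first = first-max S l≤z z≤r (≤-trans
      (≤-trans (≈⇒≤ (sym (*-identityˡ _)))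
        (*-monoʳ-≤ (0≤* (≤-trans 0≤1 1≤z) (0≤value C l≤z z≤r)) (1≤^ 1≤z k)))
      z^*zv≤1)

  -- By convexity the value at left C + θ * length C is at most θ, so from there
  -- the digit 0 is read k times.
  escapes-contract : ∀ k C {θ} → 0# ≤ θ → θ ≤ 1# → s ^ k * θ ≤ 1# →
                     total (escapes k C) ≤ (1# - θ) * length C
  escapes-contract k C {θ} 0≤θ θ≤1 s^kθ≤1 = ≤-trans
      (escapes-total k C l≤z z≤r
        (≤-trans (*-mono-≤ (<⇒≤ (^-pos 0<s k)) (0≤value C l≤z z≤r)
                   (^-monoˡ-≤ 0≤z (≤-trans z≤r (right≤s C)) k) value≤θ)
          s^kθ≤1))
      (≈⇒≤ (solve 3 (λ l r t → r :- (l :+ t :* (r :- l)) := (:1 :- t) :* (r :- l)) refl l r θ))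
    where
    l = left C
    r = right C
    z = l + θ * length C

    0<length : 0# < length C
    0<length = x<y⇒0<y-x (left<right C)

    l≤z : l ≤ z
    l≤z = x≤x+y (0≤* 0≤θ (<⇒≤ 0<length))

    0≤z : 0# ≤ z
    0≤z = ≤-trans 0≤1 (≤-trans (1≤left C) l≤z)

    z≤r : z ≤ r
    z≤r = ≤-from (0≤* (x≤y⇒0≤y-x θ≤1) (<⇒≤ 0<length))
      (solve 3 (λ l r t → r :- (l :+ t :* (r :- l)) := (:1 :- t) :* (r :- l)) refl l r θ)

    value≤θ : value C z ≤ θ
    value≤θ = *-cancelˡ-≤ 0<length (≤-trans (value-convex C ≤-refl l≤z z≤r ≤-refl)
      (≤-trans (+-mono-≤ (≈⇒≤ (trans (*-congˡ (value-left C)) (zeroʳ (r - z))))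
                         (*-monoˡ-≤ (x≤y⇒0≤y-x l≤z) (value-right≤1 C)))
        (≈⇒≤ (solve 3 (λ l r t → :0 :+ ((l :+ t :* (r :- l)) :- l) :* :1 := (r :- l) :* t)
                refl l r θ))))

  concatMap-total : ∀ (f : Cylinder → List Cylinder) {κ} → (∀ C → total (f C) ≤ κ * length C) →
                    ∀ Cs → total (concatMap f Cs) ≤ κ * total Cs
  concatMap-total f {κ} f≤ []       = ≈⇒≤ (sym (zeroʳ κ))
  concatMap-total f {κ} f≤ (C ∷ Cs) = ≤-trans (≈⇒≤ (total-++ (f C) (concatMap f Cs)))
    (≤-trans (+-mono-≤ (f≤ C) (concatMap-total f f≤ Cs)) (≈⇒≤ (sym (distribˡ κ (length C) (total Cs)))))

  -- The index is one less than the number of digits fixed, since `root` already accounts for the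
  -- first digit.
  prefixCylinders : ℕ → List Cylinder
  prefixCylinders zero    = pieces rootSplitting
  prefixCylinders (suc n) = concatMap children (prefixCylinders n)

  prefixCylinders-total : ∀ n → total (prefixCylinders n) ≤ s - 1#
  prefixCylinders-total zero    = ≈⇒≤ (pieces-total rootSplitting)
  prefixCylinders-total (suc n) = ≤-trans
    (concatMap-total children (λ C → ≈⇒≤ (trans (pieces-total (splitting C)) (sym (*-identityˡ (length C)))))
      (prefixCylinders n))
    (≤-trans (≈⇒≤ (*-identityˡ (total (prefixCylinders n)))) (prefixCylinders-total n))

  -- A failed attempt stops at its nonzero digit and the next one starts right after it, so the
  -- cylinders of one list may fix different numbers of digits.
  survivors : ℕ → ℕ → ℕ → List Cylinder
  survivors N k zero    = prefixCylinders N
  survivors N k (suc j) = concatMap (escapes k) (survivors N k j)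

  0≤total : ∀ Cs → 0# ≤ total Cs
  0≤total []       = ≤-refl
  0≤total (C ∷ Cs) = 0≤+ (x≤y⇒0≤y-x (left≤right C)) (0≤total Cs)

  -- The factor `1 + j θ` replaces the inverse of `(1 - θ) ^ j`: the induction step is
  -- `(1 + (j + 1) θ) (1 - θ) ≤ 1 + j θ`, whose gap is `(j + 1) θ * θ`. This linear decay suffices
  -- when `j` is a large multiple of `s ^ k`.
  survivors-total : ∀ N k {θ} → 0# ≤ θ → θ ≤ 1# → s ^ k * θ ≤ 1# → ∀ j →
                    (1# + fromℕ j * θ) * total (survivors N k j) ≤ s - 1#
  survivors-total N k {θ} 0≤θ θ≤1 s^kθ≤1 zero = ≤-trans
    (≈⇒≤ (solve 2 (λ t V → (:1 :+ :0 :* t) :* V := V) refl θ (total (survivors N k 0))))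
    (prefixCylinders-total N)
  survivors-total N k {θ} 0≤θ θ≤1 s^kθ≤1 (suc j) = ≤-trans
    (≤-trans
      (*-monoˡ-≤ (0≤+ 0≤1 (0≤* (0≤fromℕ (suc j)) 0≤θ))
        (concatMap-total (escapes k) (λ C → escapes-contract k C 0≤θ θ≤1 s^kθ≤1) (survivors N k j)))
      (≤-from (0≤* (0≤* (0≤fromℕ (suc j)) (0≤* 0≤θ 0≤θ)) (0≤total (survivors N k j)))
        (solve 3 (λ t V n → (:1 :+ n :* t) :* V :- (:1 :+ (:1 :+ n) :* t) :* ((:1 :- t) :* V) :=
                   (:1 :+ n) :* (t :* t) :* V) refl θ (total (survivors N k j)) (fromℕ j))))
    (survivors-total N k 0≤θ θ≤1 s^kθ≤1 j)

  module _ {q} (1<q : 1# < q) (q<s : q < s) where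
    open Greedy ℝ M q

    private
      q<1+M : q < fromℕ (suc M)
      q<1+M = <-≤-trans q<s s≤1+M

    -- C is a cylinder of q for its first n digits.
    At : ℕ → Cylinder → Set
    At n = Contains q (remainder n)

    step : ∀ {n C} → At n C →
           digit n ≡ Fin.zero × At (suc n) (first (splitting C)) ⊎
           Any (At (suc n)) (rest (splitting C))
    step {n} {C} (contains l≤q q<r value≈rem) =
      Sum.map (λ (d≡0 , at) → Fin.toℕ-injective d≡0 , Contains-resp next at)
              (Any.map (Contains-resp next))
        (pieces-cover (splitting C) l≤q q<r (toℕ (digit n))
          (≤-trans (proj₁ bounds) (≈⇒≤ (sym next))) (<-respˡ-≈ (sym next) (proj₂ bounds)))
      where
      bounds = remainder-suc-bounds 1<q q<1+M n

      next : q * value C q - fromℕ (toℕ (digit n)) ≈ remainder (suc n)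
      next = +-congʳ (*-congˡ value≈rem)

    -- As `root` carries `q - 1`, its piece for `d` belongs to the first digit `suc d`; the first
    -- digit 0 is excluded by `1 < q`.
    root-step : Any (At 1) (pieces rootSplitting)
    root-step = root-digit (toℕ (digit 0)) (remainder-suc-bounds 1<q q<1+M 0)
      where
      root-digit : ∀ d → 0# ≤ q * 1# - fromℕ d × q * 1# - fromℕ d < 1# →
                   Any (Contains q (q * 1# - fromℕ d)) (pieces rootSplitting)
      root-digit zero (_ , q<1) = contradiction
        (<-respˡ-≈ (solve 1 (λ q → q :* :1 :- :0 := q) refl q) q<1) (asym 1<q)
      root-digit (suc d) (0≤ , <1) = Any.map (Contains-resp shift)
        ([ (λ (_ , at) → here at) , there ]′
          (pieces-cover rootSplitting (<⇒≤ 1<q) q<s d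
            (≤-trans 0≤ (≈⇒≤ (sym shift))) (<-respˡ-≈ (sym shift) <1)))
        where
        shift : q - 1# - fromℕ d ≈ q * 1# - fromℕ (suc d)
        shift = solve 2 (λ q d → q :- :1 :- d := q :* :1 :- (:1 :+ d)) refl q (fromℕ d)

    prefix-cover : ∀ n → Any (At (suc n)) (prefixCylinders n)
    prefix-cover zero    = root-step
    prefix-cover (suc n) = concatMap⁺ children
      (Any.map (λ at → [ (λ (_ , at′) → here at′) , there ]′ (step {suc n} at)) (prefix-cover n))

    ZeroRun : ℕ → ℕ → Set
    ZeroRun n k = ∀ i → i ℕ.< k → digit (n ℕ.+ i) ≡ Fin.zero

    -- How many digits are fixed around `q` depends on `q`. The lower bound makes `m` large, and the
    -- upper bound controls its logarithm.
    Reached : (lo hi : ℕ) → List Cylinder → Set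
    Reached lo hi Cs = ∃ λ n → lo ℕ.≤ n × n ℕ.≤ hi × Any (At n) Cs

    escapes-cover : ∀ k {n C} → At n C → ZeroRun n k ⊎ Reached n (n ℕ.+ k) (escapes k C)
    escapes-cover zero    at = inj₁ λ _ ()
    escapes-cover (suc k) {n} {C} at =
      [ (λ (d≡0 , at′) → Sum.map (extend d≡0) later (escapes-cover k {suc n} at′)) , inj₂ ∘ now ]′ (step {n} at)
      where
      extend : digit n ≡ Fin.zero → ZeroRun (suc n) k → ZeroRun n (suc k)
      extend d≡0 run zero    _           = ≡.trans (≡.cong digit (ℕ.+-identityʳ n)) d≡0
      extend d≡0 run (suc i) (ℕ.s≤s i<k) = ≡.trans (≡.cong digit (ℕ.+-suc n i)) (run i i<k)

      later : Reached (suc n) (suc n ℕ.+ k) (escapes k (first (splitting C))) →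
              Reached n (n ℕ.+ suc k) (escapes (suc k) C)
      later (m , n<m , m≤ , any) = m , ℕ.<⇒≤ n<m , ≡.subst (m ℕ.≤_) (≡.sym (ℕ.+-suc n k)) m≤ ,
        ++⁺ʳ (rest (splitting C)) any

      now : Any (At (suc n)) (rest (splitting C)) → Reached n (n ℕ.+ suc k) (escapes (suc k) C)
      now any = suc n , ℕ.n≤1+n n , ℕ.m<m+n n ℕ.z<s , ++⁺ˡ any

    FoundRun : (lo hi k : ℕ) → Set
    FoundRun lo hi k = ∃ λ n → lo ℕ.≤ n × n ℕ.+ k ℕ.≤ hi × ZeroRun n k

    concatMap-escapes-cover : ∀ k {lo n hi Cs} → lo ℕ.≤ n → n ℕ.+ k ℕ.≤ hi → Any (At n) Cs →
                              FoundRun lo hi k ⊎ Reached lo hi (concatMap (escapes k) Cs)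
    concatMap-escapes-cover k {lo} {n} {hi} {C ∷ Cs} lo≤n n+k≤hi (here at) =
      Sum.map (λ run → n , lo≤n , n+k≤hi , run)
              (λ (m , n≤m , m≤ , any) → m , ℕ.≤-trans lo≤n n≤m , ℕ.≤-trans m≤ n+k≤hi , ++⁺ˡ any)
              (escapes-cover k {n} at)
    concatMap-escapes-cover k {Cs = C ∷ Cs} lo≤n n+k≤hi (there any) =
      Sum.map₂ (λ (m , lo≤m , m≤hi , any′) → m , lo≤m , m≤hi , ++⁺ʳ (escapes k C) any′)
               (concatMap-escapes-cover k lo≤n n+k≤hi any)

    -- After the `suc N` digits of the prefix, each attempt reads at most `k` more.
    survivors-cover : ∀ N k j → FoundRun N (suc N ℕ.+ j ℕ.* k) k ⊎
                                Reached N (suc N ℕ.+ j ℕ.* k) (survivors N k j)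
    survivors-cover N k zero = inj₂
      (suc N , ℕ.n≤1+n N , ℕ.≤-reflexive (≡.sym (ℕ.+-identityʳ (suc N))) , prefix-cover N)
    survivors-cover N k (suc j) =
      [ (λ (n , N≤n , n+k≤ , run) → inj₁
          (n , N≤n , ℕ.≤-trans n+k≤ (ℕ.+-monoʳ-≤ (suc N) (ℕ.m≤n+m (j ℕ.* k) k)) , run))
      , (λ (n , N≤n , n≤ , any) → concatMap-escapes-cover k N≤n (n+k≤ n≤) any) ]′
      (survivors-cover N k j)
      where
      n+k≤ : ∀ {n} → n ℕ.≤ suc N ℕ.+ j ℕ.* k → n ℕ.+ k ℕ.≤ suc N ℕ.+ suc j ℕ.* k
      n+k≤ n≤ = ℕ.≤-trans (ℕ.+-monoˡ-≤ k n≤) (ℕ.≤-reflexive (≡.trans (ℕ.+-assoc (suc N) (j ℕ.* k) k)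
                  (≡.cong (suc N ℕ.+_) (ℕ.+-comm (j ℕ.* k) k))))

-- Choice of the block length and bounds for logarithms.

module Growth (em : ExcludedMiddle 0ℓ) (ℝ : CompleteOrderedField) where
  open CompleteOrderedField ℝ hiding (zero)
  open RealAnalysis ℝ
  open OrderedFieldProperties ℝ

  -- Bernoulli's inequality is linear only, so it is applied to half the exponent and squared: with
  -- `k = 2 j` the term `(j h) ^ 2` dominates as soon as `j * (h * h)` is at least `A + 2 B`.
  linear≤exponential : ∀ {ρ A B} → 1# < ρ → 0# ≤ A → 0# ≤ B → ∃ λ k → A + B * fromℕ k ≤ ρ ^ k
  linear≤exponential {ρ} {A} {B} 1<ρ 0≤A 0≤B = suc i ℕ.+ suc i , ≤-trans
      (≤-from
        (0≤+ (0≤+ (0≤+ 0≤1 (0≤* (0≤+ 0≤j 0≤j) (<⇒≤ 0<h))) (0≤* 0≤j (x≤y⇒0≤y-x A+2B≤jh²)))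
             (0≤* 0≤A (0≤fromℕ i)))
        (trans (+-congˡ (-‿cong (+-congˡ (*-congˡ (fromℕ-+ (suc i) (suc i))))))
          (solve 4 (λ A B h i →
              let j = :1 :+ i in
              (:1 :+ j :* h) :* (:1 :+ j :* h) :- (A :+ B :* (j :+ j)) :=
              :1 :+ (j :+ j) :* h :+ j :* (j :* (h :* h) :- (A :+ (B :+ B))) :+ A :* i)
            refl A B h (fromℕ i))))
      (≤-trans (*-mono-≤ (<⇒≤ (^-pos 0<ρ (suc i))) 0≤1+jh 1+jh≤ρ^j 1+jh≤ρ^j)
        (≈⇒≤ (sym (^-homo-* ρ (suc i) (suc i)))))
    where
    h = ρ - 1#

    0<h : 0# < h
    0<h = x<y⇒0<y-x 1<ρ

    0<ρ : 0# < ρ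
    0<ρ = <-trans 0<1 1<ρ

    large = archimedean em ((A + (B + B)) * (h * h) ⁻¹)
    i = proj₁ large
    j = fromℕ (suc i)

    0≤j : 0# ≤ j
    0≤j = 0≤fromℕ (suc i)

    0≤1+jh : 0# ≤ 1# + j * h
    0≤1+jh = 0≤+ 0≤1 (0≤* 0≤j (<⇒≤ 0<h))

    0<h² : 0# < h * h
    0<h² = *-pos 0<h 0<h

    A+2B≤jh² : A + (B + B) ≤ j * (h * h)
    A+2B≤jh² = ≤-trans
      (≈⇒≤ (sym (trans (*-assoc _ _ _)
        (trans (*-congˡ (trans (*-comm _ _) (*-inverseʳ-pos 0<h²))) (*-identityʳ _)))))
      (*-monoʳ-≤ (<⇒≤ 0<h²) (≤-trans (proj₂ large) (fromℕ-mono-≤ (ℕ.n≤1+n i))))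

    1+jh≤ρ^j : 1# + j * h ≤ ρ ^ suc i
    1+jh≤ρ^j = ≤-trans (bernoulli (<⇒≤ 0<h) (suc i))
      (≈⇒≤ (^-congˡ (suc i) (solve 1 (λ ρ → :1 :+ (ρ :- :1) := ρ) refl ρ)))

  -- J blocks of length 1 + k, with J of order C s ^ (1 + k), end before r ^ k.
  blocks : ∀ {s r C} → 1# < s → s < r → 0# ≤ C → ∀ N →
           ∃₂ λ k J → fromℕ (suc N ℕ.+ J ℕ.* suc k) ≤ r ^ k × C * s ^ suc k ≤ fromℕ J
  blocks {s} {r} {C} 1<s s<r 0≤C N = k , J , end≤r^k ,
      ≤-trans (≈⇒≤ (sym (*-assoc C s (s ^ k)))) (proj₁ (proj₂ ceil))
    where
    0<s : 0# < s
    0<s = <-trans 0<1 1<s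

    ρ = r * s ⁻¹
    -- Blocks have length `1 + k` while the target is `r ^ k`; the surplus factor `s` goes into the
    -- constant.
    D = C * s

    0≤D : 0# ≤ D
    0≤D = 0≤* 0≤C (<⇒≤ 0<s)

    1<ρ : 1# < ρ
    1<ρ = <-respˡ-≈ (*-inverseʳ-pos 0<s) (*-monoʳ-< (⁻¹-pos 0<s) s<r)

    sρ≈r : s * ρ ≈ r
    sρ≈r = trans (solve 3 (λ s r i → s :* (r :* i) := s :* i :* r) refl s r (s ⁻¹))
      (trans (*-congʳ (*-inverseʳ-pos 0<s)) (*-identityˡ r))

    -- Since `J ≤ 1 + D * s ^ k` and `s ^ k ≥ 1`, the last position divided by `s ^ k` is at most
    -- `suc N + (D + 1) + (D + 1) * k`.
    growth = linear≤exponential {ρ} {fromℕ (suc N) + (D + 1#)} {D + 1#} 1<ρ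
      (0≤+ (0≤fromℕ (suc N)) (0≤+ 0≤D 0≤1)) (0≤+ 0≤D 0≤1)
    k = proj₁ growth

    1≤s^k : 1# ≤ s ^ k
    1≤s^k = 1≤^ (<⇒≤ 1<s) k

    ceil = ceiling em (0≤* 0≤D (≤-trans 0≤1 1≤s^k))
    J = proj₁ ceil

    end≤r^k : fromℕ (suc N ℕ.+ J ℕ.* suc k) ≤ r ^ k
    end≤r^k = ≤-trans
      (≈⇒≤ (trans (fromℕ-+ (suc N) (J ℕ.* suc k)) (+-congˡ (fromℕ-* J (suc k)))))
      (≤-trans (+-mono-≤ ≤-refl (*-monoʳ-≤ (0≤fromℕ (suc k)) (proj₂ (proj₂ ceil))))
        (≤-trans
          (≤-from (0≤* (x≤y⇒0≤y-x 1≤s^k) (0≤+ (0≤fromℕ (suc N)) (0≤fromℕ (suc k))))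
            (solve 4 (λ n d e k →
                e :* (n :+ (d :+ :1) :+ (d :+ :1) :* k) :- (n :+ (:1 :+ d :* e) :* (:1 :+ k)) :=
                (e :- :1) :* (n :+ (:1 :+ k)))
              refl (fromℕ (suc N)) D (s ^ k) (fromℕ k)))
          (≤-trans (*-monoˡ-≤ (≤-trans 0≤1 1≤s^k) (proj₂ growth))
            (≈⇒≤ (trans (sym (^-distrib-* s ρ k)) (^-congˡ k sρ≈r))))))

  -- If `a / b` is an admissible exponent, then `r ^ a ≤ m ^ b ≤ r ^ (k * b)`, which forces
  -- `a ≤ k * b`; completeness then supplies the logarithm.
  log-bound : ∀ {r} → 1# < r → ∀ {m k} → 1 ℕ.≤ m → fromℕ m ≤ r ^ k →
              ∃ λ ℓ → IsLog r (fromℕ m) ℓ × ℓ ≤ fromℕ k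
  log-bound {r} 1<r {m} {k} 1≤m m≤r^k =
    proj₁ sup , proj₂ sup , proj₂ (proj₂ sup) (fromℕ k) below
    where
    Exponent : Carrier → Set
    Exponent p = ∃₂ λ a b → (p ≈ fromℕ a * (fromℕ (suc b)) ⁻¹) × (r ^ a ≤ fromℕ m ^ suc b)

    ^-assoc : ∀ x m n → (x ^ m) ^ n ≈ x ^ (m ℕ.* n)
    ^-assoc = Exp.^-assocʳ semiring

    below : UpperBound Exponent (fromℕ k)
    below p (a , b , p≈ , r^a≤m^b) = ≤-trans (≈⇒≤ p≈)
      (≤-trans (*-monoʳ-≤ (<⇒≤ (⁻¹-pos (0<fromℕ-suc b)))
                 (≤-trans (fromℕ-mono-≤ a≤k*b) (≈⇒≤ (fromℕ-* k (suc b)))))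
        (≈⇒≤ (trans (*-assoc _ _ _)
          (trans (*-congˡ (*-inverseʳ-pos (0<fromℕ-suc b))) (*-identityʳ (fromℕ k))))))
      where
      a≤k*b : a ℕ.≤ k ℕ.* suc b
      a≤k*b = ℕ.≮⇒≥ λ k*b<a → <⇒≱ (^-monoʳ-< 1<r k*b<a)
        (≤-trans r^a≤m^b (≤-trans (^-monoˡ-≤ (0≤fromℕ m) m≤r^k (suc b))
          (≈⇒≤ (^-assoc r k (suc b)))))

    sup : ∃ (Supremum Exponent)
    sup = complete Exponent
      -- The exponent 0 is admissible because `m ≥ 1`.
      (0# , 0 , 0 , sym (zeroˡ _) , ≤-trans (≤-trans (≈⇒≤ (sym fromℕ-1)) (fromℕ-mono-≤ 1≤m))
                                      (≈⇒≤ (sym (*-identityʳ (fromℕ m)))))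
      (fromℕ k , below)

-- Merging finite lists of intervals into one sequence.

module Intervals (ℝ : CompleteOrderedField) where
  open CompleteOrderedField ℝ hiding (zero)
  open RealAnalysis ℝ
  open OrderedFieldProperties ℝ

  record Interval : Set where
    constructor interval
    field
      lower upper : Carrier
      lower≤upper : lower ≤ upper

    width : Carrier
    width = upper - lower

  open Interval public

  _∈_ : Carrier → Interval → Set
  x ∈ I = OpenInterval (lower I) (upper I) x

  totalWidth : List Interval → Carrier
  totalWidth []       = 0#
  totalWidth (I ∷ Is) = width I + totalWidth Is

  -- The concatenation of Is, L 0, L 1, …, with an empty interval after each list.
  flatten : List Interval → (ℕ → List Interval) → ℕ → Interval
  flatten []       L zero    = interval 0# 0# ≤-refl
  flatten []       L (suc i) = flatten (L 0) (L ∘ suc) i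
  flatten (I ∷ Is) L zero    = I
  flatten (I ∷ Is) L (suc i) = flatten Is L i

  0≤totalWidth : ∀ Is → 0# ≤ totalWidth Is
  0≤totalWidth []       = ≤-refl
  0≤totalWidth (I ∷ Is) = 0≤+ (x≤y⇒0≤y-x (lower≤upper I)) (0≤totalWidth Is)

  -- Here `e n` is the budget left for the lists from `L n` on: each list pays its width out of it,
  -- so no infinite series is summed. The separating intervals have width 0.
  flatten-width : ∀ Is L {e : ℕ → Carrier} → (∀ n → 0# ≤ e n) → (∀ n → totalWidth (L n) + e (suc n) ≤ e n) →
                  ∀ n → partialSum (λ i → width (flatten Is L i)) n ≤ totalWidth Is + e 0
  flatten-width Is L 0≤e L≤e zero = 0≤+ (0≤totalWidth Is) (0≤e 0)
  flatten-width [] L {e} 0≤e L≤e (suc n) =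
    ≤-trans (≈⇒≤ (trans (+-congʳ (-‿inverseʳ 0#)) (+-identityˡ _)))
      (≤-trans (flatten-width (L 0) (L ∘ suc) {e ∘ suc} (0≤e ∘ suc) (L≤e ∘ suc) n)
        (≤-trans (L≤e 0) (≈⇒≤ (sym (+-identityˡ (e 0))))))
  flatten-width (I ∷ Is) L {e} 0≤e L≤e (suc n) =
    ≤-trans (+-mono-≤ (≤-refl {width I}) (flatten-width Is L {e} 0≤e L≤e n))
      (≈⇒≤ (sym (+-assoc (width I) (totalWidth Is) (e 0))))

  flatten-head : ∀ {x : Carrier} {Is} L → Any (x ∈_) Is → ∃ λ i → x ∈ flatten Is L i
  flatten-head L (here x∈I)  = 0 , x∈I
  flatten-head L (there any) = suc (proj₁ (flatten-head L any)) , proj₂ (flatten-head L any)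

  flatten-tail : ∀ {x : Carrier} Is L n → Any (x ∈_) (L n) → ∃ λ i → x ∈ flatten Is L i
  flatten-tail (I ∷ Is) L n       any = suc (proj₁ tail) , proj₂ tail
    where tail = flatten-tail Is L n any
  flatten-tail []       L zero    any = suc (proj₁ head) , proj₂ head
    where head = flatten-head (L ∘ suc) any
  flatten-tail []       L (suc n) any = suc (proj₁ tail) , proj₂ tail
    where tail = flatten-tail (L 0) (L ∘ suc) n any

-- Covering the exceptional bases.

module Covering (em : ExcludedMiddle 0ℓ) (ℝ : CompleteOrderedField) (M : ℕ) where
  open CompleteOrderedField ℝ hiding (zero)
  open RealAnalysis ℝ
  open OrderedFieldProperties ℝ
  open Growth em ℝ
  open Intervals ℝ

  LongRunFrom : Carrier → ℕ → DigitSeq {M} → Set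
  LongRunFrom r N β = ∃ λ m → (N ℕ.≤ m) ×
    ∃₂ λ k ℓ → EndsWithZeros k (applyUpTo β m) × IsLog r (fromℕ m) ℓ × (ℓ < fromℕ k)

  applyUpTo-zeros : ∀ k (β : DigitSeq {M}) → (∀ i → i ℕ.< k → β i ≡ Fin.zero) →
                    applyUpTo β k ≡ replicate k Fin.zero
  applyUpTo-zeros zero    β β≡0 = ≡.refl
  applyUpTo-zeros (suc k) β β≡0 = ≡.cong₂ _∷_ (β≡0 0 ℕ.z<s)
    (applyUpTo-zeros k (β ∘ suc) λ i i<k → β≡0 (suc i) (ℕ.s<s i<k))

  endsWithZeros : ∀ n k (β : DigitSeq {M}) → (∀ i → i ℕ.< k → β (n ℕ.+ i) ≡ Fin.zero) →
                  EndsWithZeros k (applyUpTo β (n ℕ.+ k))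
  endsWithZeros zero    k β β≡0 = [] , applyUpTo-zeros k β β≡0
  endsWithZeros (suc n) k β β≡0 = β 0 ∷ proj₁ ih , ≡.cong (β 0 ∷_) (proj₂ ih)
    where ih = endsWithZeros n k (β ∘ suc) β≡0

  -- The membership relation is a parameter, to serve for half-open cylinders as well as for open
  -- intervals.
  Covers : (s r : Carrier) → ℕ → {A : Set} → (Carrier → A → Set) → List A → Set
  Covers s r N _∈′_ As =
    ∀ {q} → 1# < q → q < s → LongRunFrom r N (Greedy.digit ℝ M q) ⊎ Any (q ∈′_) As

  module _ {s r} (1<s : 1# < s) (s<r : s < r) (s≤1+M : s ≤ fromℕ (suc M)) where
    open Cylinders em ℝ s
    open Subdivision em ℝ s M 1<s s≤1+M
    open Cylinder using (left; right; left<right)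

    InCylinder : Carrier → Cylinder → Set
    InCylinder q C = left C ≤ q × q < right C

    -- Take `θ = s ^ (- K)` and `C = (s - 1) / τ`. The hypothesis says `C ≤ J θ`, so `C` times the
    -- total is at most `s - 1`, which is `C τ`.
    survivors-small : ∀ N {τ} → 0# < τ → ∀ K J → (s - 1#) * τ ⁻¹ * s ^ K ≤ fromℕ J →
                      total (survivors N K J) ≤ τ
    survivors-small N {τ} 0<τ K J Cs^K≤J = *-cancelˡ-≤ 0<C (≤-trans
        (*-monoʳ-≤ (0≤total (survivors N K J))
          (≤-trans C≤Jθ (<⇒≤ (<-respʳ-≈ (+-comm _ _) (x<x+y 0<1)))))
        (≤-trans (survivors-total N K (<⇒≤ 0<θ) θ≤1 (≈⇒≤ s^Kθ≈1) J) (≈⇒≤ (sym Cτ≈s-1))))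
      where
      C = (s - 1#) * τ ⁻¹

      0<C : 0# < C
      0<C = *-pos (x<y⇒0<y-x 1<s) (⁻¹-pos 0<τ)

      θ = (s ⁻¹) ^ K

      0<θ : 0# < θ
      0<θ = ^-pos (⁻¹-pos 0<s) K

      s^Kθ≈1 : s ^ K * θ ≈ 1#
      s^Kθ≈1 = trans (sym (^-distrib-* s (s ⁻¹) K)) (trans (^-congˡ K (*-inverseʳ-pos 0<s)) (1^ K))

      θ≤1 : θ ≤ 1#
      θ≤1 = ≤-trans (≈⇒≤ (sym (*-identityˡ θ)))
        (≤-trans (*-monoʳ-≤ (<⇒≤ 0<θ) (1≤^ (<⇒≤ 1<s) K)) (≈⇒≤ s^Kθ≈1))

      C≤Jθ : C ≤ fromℕ J * θ
      C≤Jθ = ≤-trans (≈⇒≤ (sym (trans (*-assoc _ _ _) (trans (*-congˡ s^Kθ≈1) (*-identityʳ C)))))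
        (*-monoʳ-≤ (<⇒≤ 0<θ) Cs^K≤J)

      Cτ≈s-1 : C * τ ≈ s - 1#
      Cτ≈s-1 = trans (solve 3 (λ a i t → a :* i :* t := a :* (t :* i)) refl (s - 1#) (τ ⁻¹) τ)
        (trans (*-congˡ (*-inverseʳ-pos 0<τ)) (*-identityʳ (s - 1#)))

    survivors-covers : ∀ N k J → fromℕ (suc N ℕ.+ J ℕ.* suc k) ≤ r ^ k →
                       Covers s r N InCylinder (survivors N (suc k) J)
    survivors-covers N k J end≤r^k {q} 1<q q<s = Sum.map long-run
        (λ (_ , _ , _ , any) → Any.map (λ (contains l≤q q<r _) → l≤q , q<r) any)
        (survivors-cover 1<q q<s N (suc k) J)
      where
      long-run : FoundRun 1<q q<s N (suc N ℕ.+ J ℕ.* suc k) (suc k) →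
                 LongRunFrom r N (Greedy.digit ℝ M q)
      long-run (n , N≤n , n+K≤end , run) = n ℕ.+ suc k , ℕ.≤-trans N≤n (ℕ.m≤m+n n (suc k)) ,
        suc k , proj₁ log , endsWithZeros n (suc k) (Greedy.digit ℝ M q) run , proj₁ (proj₂ log) ,
        ≤-<-trans (proj₂ (proj₂ log)) (<-respʳ-≈ (+-comm (fromℕ k) 1#) (x<x+y 0<1))
        where
        log = log-bound (<-trans 1<s s<r) {k = k} (ℕ.≤-trans (ℕ.s≤s ℕ.z≤n) (ℕ.m≤n+m (suc k) n))
          (≤-trans (fromℕ-mono-≤ n+K≤end) end≤r^k)

    stage-cylinders : ∀ N {τ} → 0# < τ → ∃ λ Cs → total Cs ≤ τ × Covers s r N InCylinder Cs
    stage-cylinders N {τ} 0<τ =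
      let k , J , end≤r^k , Cs^K≤J = blocks 1<s s<r (<⇒≤ (*-pos (x<y⇒0<y-x 1<s) (⁻¹-pos 0<τ))) N
      in survivors N (suc k) J , survivors-small N 0<τ (suc k) J Cs^K≤J , survivors-covers N k J end≤r^k

    -- Null sets ask for open intervals, but a cylinder contains its left end. Widening by its own
    -- length on both sides costs the factor 3, however many cylinders there are.
    enlarge : Cylinder → Interval
    enlarge C = interval (left C - length C) (right C + length C)
      (≤-trans (x-y≤x 0≤length) (≤-trans (<⇒≤ (left<right C)) (x≤x+y 0≤length)))
      where
      0≤length : 0# ≤ length C
      0≤length = <⇒≤ (x<y⇒0<y-x (left<right C))

    ∈-enlarge : ∀ {C x} → left C ≤ x × x < right C → x ∈ enlarge C
    ∈-enlarge {C} (l≤x , x<r) =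
      <-≤-trans (x-y<x 0<length) l≤x , <-trans x<r (x<x+y 0<length)
      where
      0<length : 0# < length C
      0<length = x<y⇒0<y-x (left<right C)

    enlarge-total : ∀ Cs → totalWidth (map enlarge Cs) ≈ fromℕ 3 * total Cs
    enlarge-total []       = sym (zeroʳ (fromℕ 3))
    enlarge-total (C ∷ Cs) = trans (+-congˡ (enlarge-total Cs))
      (solve 3 (λ l r V → let d = r :- l ; three = :1 :+ (:1 :+ (:1 :+ :0)) in
          ((r :+ d) :- (l :- d)) :+ three :* V := three :* (d :+ V))
        refl (left C) (right C) (total Cs))

    stage : ∀ N {τ} → 0# < τ → ∃ λ Is → totalWidth Is ≤ τ × Covers s r N _∈_ Is
    stage N {τ} 0<τ =
      -- A third of the tolerance, to pay for the enlargement.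
      let Cs , Cs≤ , covers = stage-cylinders N (*-pos 0<τ (⁻¹-pos (0<fromℕ-suc 2))) in
      map enlarge Cs ,
      ≤-trans (≈⇒≤ (enlarge-total Cs))
        (≤-trans (*-monoˡ-≤ (0≤fromℕ 3) Cs≤)
          (≈⇒≤ (trans (solve 3 (λ a t i → a :* (t :* i) := a :* i :* t) refl (fromℕ 3) τ (fromℕ 3 ⁻¹))
            (trans (*-congʳ (*-inverseʳ-pos (0<fromℕ-suc 2))) (*-identityˡ τ))))) ,
      λ 1<q q<s → Sum.map₂ (map⁺ ∘ Any.map (λ {C} → ∈-enlarge {C})) (covers 1<q q<s)

  half : Carrier
  half = (1# + 1#) ⁻¹

  0<half : 0# < half
  0<half = ⁻¹-pos (0<+ 0<1 0≤1)

  half+half : ∀ x → x * half + x * half ≈ x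
  half+half x = trans (solve 2 (λ x h → x :* h :+ x :* h := (:1 :+ :1) :* h :* x) refl x half)
    (trans (*-congʳ (*-inverseʳ-pos (0<+ 0<1 0≤1))) (*-identityˡ x))

  x*half<x : ∀ {x} → 0# < x → x * half < x
  x*half<x {x} 0<x = <-respʳ-≈ (half+half x) (x<x+y (*-pos 0<x 0<half))

  -- When `r - δ` is not above 1, the midpoint of 1 and `r` serves instead.
  close-below : ∀ {r δ} → 1# < r → 0# < δ → ∃ λ s → 1# < s × s < r × r - s ≤ δ
  close-below {r} {δ} 1<r 0<δ = [ wide , narrow ]′ (≤-<-connex (r - δ) 1#)
    where
    wide : r - δ ≤ 1# → ∃ λ s → 1# < s × s < r × r - s ≤ δ
    wide r-δ≤1 = r - d ,
      <-from (x<y⇒0<y-x d<r-1) (solve 2 (λ r d → (r :- d) :- :1 := (r :- :1) :- d) refl r d) ,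
      x-y<x 0<d ,
      ≤-trans (≈⇒≤ (solve 2 (λ r d → r :- (r :- d) := d) refl r d))
        (≤-trans (<⇒≤ d<r-1)
          (≤-from (x≤y⇒0≤y-x r-δ≤1) (solve 2 (λ r d → d :- (r :- :1) := :1 :- (r :- d)) refl r δ)))
      where
      d = (r - 1#) * half
      0<d : 0# < d
      0<d = *-pos (x<y⇒0<y-x 1<r) 0<half
      d<r-1 : d < r - 1#
      d<r-1 = x*half<x (x<y⇒0<y-x 1<r)

    narrow : 1# < r - δ → ∃ λ s → 1# < s × s < r × r - s ≤ δ
    narrow 1<r-δ = r - δ , 1<r-δ , x-y<x 0<δ , ≈⇒≤ (solve 2 (λ r d → r :- (r :- d) := d) refl r δ)

  module _ {s r ε} (s<r : s < r) (r≤1+M : r ≤ fromℕ (suc M))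
           (0<ε : 0# < ε) (r-s≤ : r - s ≤ ε * half * half)
           (L : ℕ → List Interval)
           (L-width : ∀ N → totalWidth (L N) ≤ ε * half * half ^ suc N)
           (L-covers : ∀ N → Covers s r N _∈_ (L N)) where

    private
      -- One half of `ε` is shared among the lists `L N`; the other half pays for `end`.
      budget : ℕ → Carrier
      budget n = ε * half * half ^ n

      0≤budget : ∀ n → 0# ≤ budget n
      0≤budget n = <⇒≤ (*-pos (*-pos 0<ε 0<half) (^-pos 0<half n))

      budget-suc : ∀ n → budget (suc n) + budget (suc n) ≈ budget n
      budget-suc n = trans
        (solve 3 (λ e h p → e :* (h :* p) :+ e :* (h :* p) := e :* p :* h :+ e :* p :* h)
          refl (ε * half) half (half ^ n))
        (half+half (budget n))

      -- It starts to the left of `s` so that the open interval contains `s`; its width is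
      -- `2 (r - s)`.
      end : Interval
      end = interval (s - (r - s)) r (≤-trans (x-y≤x (<⇒≤ (x<y⇒0<y-x s<r))) (<⇒≤ s<r))

      cover : ℕ → Interval
      cover = flatten (end ∷ []) L

      width-end : width end ≤ ε * half
      width-end = ≤-trans
        (≈⇒≤ (solve 2 (λ r s → r :- (s :- (r :- s)) := (r :- s) :+ (r :- s)) refl r s))
        (≤-trans (+-mono-≤ r-s≤ r-s≤) (≈⇒≤ (half+half (ε * half))))

      cover-width : ∀ n → partialSum (λ i → width (cover i)) n ≤ ε
      cover-width n = ≤-trans
        (flatten-width (end ∷ []) L {budget} 0≤budget
          (λ N → ≤-trans (+-mono-≤ (L-width N) ≤-refl) (≈⇒≤ (budget-suc N))) n)
        (≤-trans
          (+-mono-≤ (≤-trans (≈⇒≤ (+-identityʳ (width end))) width-end) (≈⇒≤ (*-identityʳ (ε * half))))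
          (≈⇒≤ (half+half ε)))

      covered : ∀ q → OpenInterval 1# r q → ¬ GreedyHasLongZeroRuns M r q → ∃ λ i → q ∈ cover i
      covered q (1<q , q<r) ¬runs = [ near-r , below-s ]′ (≤-<-connex s q)
        where
        near-r : s ≤ q → ∃ λ i → q ∈ cover i
        near-r s≤q = 0 , <-≤-trans (x-y<x (x<y⇒0<y-x s<r)) s≤q , q<r

        below-s : q < s → ∃ λ i → q ∈ cover i
        -- If `q` lay in no interval of the cover, every `L N` would leave only the alternative of a
        -- run beyond `N`, and `q` would not be exceptional.
        below-s q<s = decidable-stable (em {∃ λ i → q ∈ cover i}) λ uncovered → ¬runs
          (Greedy.digit ℝ M q , Greedy.digit-isGreedy ℝ M q 1<q (<-≤-trans q<r r≤1+M) em ,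
            λ N → [ id , (λ any → contradiction (flatten-tail (end ∷ []) L N any) uncovered) ]′
                  (L-covers N 1<q q<s))

    stages-cover : ∃₂ λ (a b : ℕ → Carrier) →
        (∀ i → a i ≤ b i)
      × (∀ n → partialSum (λ i → b i - a i) n ≤ ε)
      × (∀ q → OpenInterval 1# r q × ¬ GreedyHasLongZeroRuns M r q → ∃ λ i → (a i < q) × (q < b i))
    stages-cover = lower ∘ cover , upper ∘ cover , lower≤upper ∘ cover , cover-width ,
      λ q (q∈ , ¬runs) → covered q q∈ ¬runs

  almostAll-longZeroRuns : ∀ r → 1# < r → r ≤ fromℕ (suc M) →
                           AlmostEverywhereOn (OpenInterval 1# r) (GreedyHasLongZeroRuns M r)
  almostAll-longZeroRuns r 1<r r≤1+M ε 0<ε =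
    let s , 1<s , s<r , r-s≤ = close-below 1<r (*-pos (*-pos 0<ε 0<half) 0<half)
        stages N = stage 1<s s<r (≤-trans (<⇒≤ s<r) r≤1+M) N
                     (*-pos (*-pos 0<ε 0<half) (^-pos 0<half (suc N)))
    in stages-cover s<r r≤1+M 0<ε r-s≤ (proj₁ ∘ stages) (λ N → proj₁ (proj₂ (stages N)))
         (λ N → proj₂ (proj₂ (stages N)))

theorem1p5 :
    ExcludedMiddle 0ℓ →
    (ℝ : CompleteOrderedField) →
    let open CompleteOrderedField ℝ
        open RealAnalysis ℝ in
    (M : ℕ) → 1 ℕ.≤ M →
    (r : Carrier) → 1# < r → r ≤ fromℕ (suc M) →
    AlmostEverywhereOn (OpenInterval 1# r) (GreedyHasLongZeroRuns M r)
theorem1p5 em ℝ M _ = Covering.almostAll-longZeroRuns em ℝ M
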